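{- Let $n\ge 1$ be an integer, set $D=2n+1$, and let $c>0$ be the fixed constant in the definition of the truncated lattice $L_{D,Q}$. There is a constant $K>0$, depending only on $D$ and $\phi_4$ (and on the fixed constant $c$), such that for every $\delta\in(0,1)$ and every $Q\in\mathbb{N}$, $Q\geq 1$, $$Q^{ -(2n+2)}\,\#\{(u,v)\in L_{D,Q}\times L_{D,Q}: |\phi_4(u,v)-Q|\le\delta\}\ \le\ K\max\{Q^{2n},\,Q^{2n+1}\delta\}.$$
   Context: Write points of $\mathbb{R}^D=\mathbb{R}^{2n}\times\mathbb{R}$ as $x=(\underline{x},\bar{x})$ with $\underline{x}\in\mathbb{R}^{2n}$, $\bar{x}\in\mathbb{R}$. Let $J=\begin{pmatrix}0&I_n\\-I_n&0\end{pmatrix}$ be the $2n\times 2n$ standard symplectic matrix. The Heisenberg group law is $x*y=(\underline{x}+\underline{y},\ \bar{x}+\bar{y}+\tfrac12\underline{x}^{\intercal}J\underline{y})$, so $y^{ -1}=-y$. The Korányi norm is $\|x\|_4=(|\underline{x}|^4+16|\bar{x}|^2)^{1/4}$ ($|\cdot|$ Euclidean), and $$\phi_4(x,y)=\|x*y^{ -1}\|_4=\Big(|\underline{x}-\underline{y}|^4+16\,\big|\bar{x}-\bar{y}+\tfrac12\underline{y}^{\intercal}J\underline{x}\big|^2\Big)^{1/4}.$$ For a fixed constant $c>0$, the truncated lattice is $$L_{D,Q}=\{b=(b_1,\dots,b_D)\in\mathbb{Z}^D: |b_i|\le cQ \text{ for } 1\le i\le D-1,\ |b_D|\le cQ^2\}.$$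 -}

module Defs where

open import Algebra.Bundles.Raw using (RawMonoid)
import Algebra.Definitions.RawMonoid as RawMonoidDefinitions
open import Data.Fin.Base using (Fin; splitAt)
open import Data.Fin.Properties using () renaming (_≟_ to _≟ᶠ_)
open import Data.Bool.Base using (if_then_else_)
open import Data.Integer.Base as ℤ using (ℤ; +_; -[1+_])
import Data.Integer.Properties as ℤ
open import Data.List.Base using (List; length)
open import Data.List.Relation.Unary.All using (All)
open import Data.List.Relation.Unary.Unique.Propositional using (Unique)
open import Data.Nat.Base as ℕ using (ℕ; zero; suc; NonZero)
import Data.Nat.Properties as ℕ
open import Data.Product.Base using (∃-syntax; _×_; _,_)
open import Data.Rational.Base as ℚ using (ℚ; mkℚ; 0ℚ; 1ℚ; ½)
import Data.Rational.Properties as ℚ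
open import Data.Rational.Solver using (module +-*-Solver)
import Data.Rational.Unnormalised.Base as ℚᵘ
import Data.Rational.Unnormalised.Properties as ℚᵘ
open import Data.Sum.Base using (inj₁; inj₂)
open import Data.Vec.Base using (Vec; lookup)
open import Data.Vec.Functional using (Vector)
open import Level using (0ℓ)
open import Relation.Binary.PropositionalEquality
  using (_≡_; refl; sym; trans; cong; cong₂; subst; subst₂)
open import Relation.Nullary.Decidable using (Dec; does; yes; no)
open import Relation.Nullary.Negation using (¬_)

module RationalLemmas where

  open +-*-Solver using (solve; _:=_; _:+_; _:*_; :-_; _:-_; con)

  p≤∣p∣ : ∀ p → p ℚ.≤ ℚ.∣ p ∣
  p≤∣p∣ p with ℚ.≤-total 0ℚ p
  ... | inj₁ 0≤p = ℚ.≤-reflexive (sym (ℚ.0≤p⇒∣p∣≡p 0≤p))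
  ... | inj₂ p≤0 = ℚ.≤-trans p≤0 (ℚ.0≤∣p∣ p)

  +-cancelʳ-≤ : ∀ r {p q} → p ℚ.+ r ℚ.≤ q ℚ.+ r → p ℚ.≤ q
  +-cancelʳ-≤ r {p} {q} h = subst₂ ℚ._≤_ (lem p) (lem q) (ℚ.+-monoˡ-≤ (ℚ.- r) h)
    where
    lem : ∀ x → (x ℚ.+ r) ℚ.- r ≡ x
    lem x = solve 2 (λ x r → (x :+ r) :- r := x) refl x r

  ∣p-q∣≤ε⇒p≤q+ε : ∀ p q {ε} → ℚ.∣ p ℚ.- q ∣ ℚ.≤ ε → p ℚ.≤ q ℚ.+ ε
  ∣p-q∣≤ε⇒p≤q+ε p q {ε} h =
    subst (ℚ._≤ q ℚ.+ ε) (solve 2 (λ p q → q :+ (p :- q) := p) refl p q)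
      (ℚ.+-monoʳ-≤ q (ℚ.≤-trans (p≤∣p∣ (p ℚ.- q)) h))

  ∣p-q∣≡∣q-p∣ : ∀ p q → ℚ.∣ p ℚ.- q ∣ ≡ ℚ.∣ q ℚ.- p ∣
  ∣p-q∣≡∣q-p∣ p q = trans (sym (ℚ.∣-p∣≡∣p∣ (p ℚ.- q)))
    (cong ℚ.∣_∣ (solve 2 (λ p q → :- (p :- q) := q :- p) refl p q))

  p≤q+ε⇒p-q≤ε : ∀ p q {ε} → p ℚ.≤ q ℚ.+ ε → p ℚ.- q ℚ.≤ ε
  p≤q+ε⇒p-q≤ε p q {ε} h =
    +-cancelʳ-≤ q (subst₂ ℚ._≤_
      (solve 2 (λ p q → p := (p :- q) :+ q) refl p q) (ℚ.+-comm q ε) h)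

  p≤q+ε∧q≤p+ε⇒∣p-q∣≤ε : ∀ p q {ε} → p ℚ.≤ q ℚ.+ ε → q ℚ.≤ p ℚ.+ ε → ℚ.∣ p ℚ.- q ∣ ℚ.≤ ε
  p≤q+ε∧q≤p+ε⇒∣p-q∣≤ε p q {ε} h k with ℚ.∣p∣≡p∨∣p∣≡-p (p ℚ.- q)
  ... | inj₁ eq = subst (ℚ._≤ ε) (sym eq) (p≤q+ε⇒p-q≤ε p q h)
  ... | inj₂ eq = subst (ℚ._≤ ε)
    (trans (solve 2 (λ p q → q :- p := :- (p :- q)) refl p q) (sym eq)) (p≤q+ε⇒p-q≤ε q p k)

  +-nonNeg : ∀ {p q} → 0ℚ ℚ.≤ p → 0ℚ ℚ.≤ q → 0ℚ ℚ.≤ p ℚ.+ q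
  +-nonNeg = ℚ.+-mono-≤

  *-monoˡ : ∀ {r p q} → 0ℚ ℚ.≤ r → p ℚ.≤ q → r ℚ.* p ℚ.≤ r ℚ.* q
  *-monoˡ {r} 0≤r = ℚ.*-monoˡ-≤-nonNeg r {{ℚ.nonNegative 0≤r}}

  *-mono : ∀ {p q r s} → 0ℚ ℚ.≤ r → 0ℚ ℚ.≤ q → p ℚ.≤ q → r ℚ.≤ s → p ℚ.* r ℚ.≤ q ℚ.* s
  *-mono {p} {q} {r} 0≤r 0≤q p≤q r≤s =
    ℚ.≤-trans (ℚ.*-monoʳ-≤-nonNeg r {{ℚ.nonNegative 0≤r}} p≤q) (*-monoˡ 0≤q r≤s)

  *-nonNeg : ∀ {p q} → 0ℚ ℚ.≤ p → 0ℚ ℚ.≤ q → 0ℚ ℚ.≤ p ℚ.* q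
  *-nonNeg {p} {q} 0≤p 0≤q = subst (ℚ._≤ p ℚ.* q) (ℚ.*-zeroʳ p) (*-monoˡ 0≤p 0≤q)

  *-pos : ∀ {p q} → 0ℚ ℚ.< p → 0ℚ ℚ.< q → 0ℚ ℚ.< p ℚ.* q
  *-pos {p} {q} 0<p 0<q =
    subst (ℚ._< p ℚ.* q) (ℚ.*-zeroʳ p) (ℚ.*-monoʳ-<-pos p {{ℚ.positive 0<p}} 0<q)

  p≤p+q : ∀ {p q} → 0ℚ ℚ.≤ q → p ℚ.≤ p ℚ.+ q
  p≤p+q {p} {q} 0≤q = subst (ℚ._≤ p ℚ.+ q) (ℚ.+-identityʳ p) (ℚ.+-monoʳ-≤ p 0≤q)

  half : ℚ → ℚ
  half ε = ½ ℚ.* ε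

  half+half : ∀ ε → half ε ℚ.+ half ε ≡ ε
  half+half ε = solve 1 (λ ε → con ½ :* ε :+ con ½ :* ε := ε) refl ε

  half-pos : ∀ {ε} → 0ℚ ℚ.< ε → 0ℚ ℚ.< half ε
  half-pos = *-pos (ℚ.positive⁻¹ ½)

  scale : ∀ {ε B} → 0ℚ ℚ.< ε → 0ℚ ℚ.< B → ∃[ η ] 0ℚ ℚ.< η × B ℚ.* η ≡ ε
  scale {ε} {B} 0<ε 0<B = (1/B ℚ.* ε)
    , *-pos (ℚ.positive⁻¹ 1/B {{ℚ.1/pos⇒pos B {{ℚ.positive 0<B}}}}) 0<ε
    , trans (sym (ℚ.*-assoc B 1/B ε))
        (trans (cong (ℚ._* ε) (ℚ.*-inverseʳ B {{B≢0}})) (ℚ.*-identityˡ ε))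
    where
    B≢0 : ℚ.NonZero B
    B≢0 = ℚ.pos⇒nonZero B {{ℚ.positive 0<B}}
    1/B : ℚ
    1/B = (ℚ.1/ B) {{B≢0}}

  _² _⁴ : ℚ → ℚ
  p ² = p ℚ.* p
  p ⁴ = (p ²) ²

  ²-mono : ∀ {p q} → 0ℚ ℚ.≤ p → p ℚ.≤ q → p ² ℚ.≤ q ²
  ²-mono 0≤p p≤q = *-mono 0≤p (ℚ.≤-trans 0≤p p≤q) p≤q p≤q

  ²-nonNeg : ∀ {p} → 0ℚ ℚ.≤ p → 0ℚ ℚ.≤ p ²
  ²-nonNeg 0≤p = *-nonNeg 0≤p 0≤p

  ²-superadditive : ∀ {p q} → 0ℚ ℚ.≤ p → 0ℚ ℚ.≤ q → p ² ℚ.+ q ² ℚ.≤ (p ℚ.+ q) ²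
  ²-superadditive {p} {q} 0≤p 0≤q = subst (p ² ℚ.+ q ² ℚ.≤_)
    (solve 2 (λ p q → p :* p :+ q :* q :+ (p :* q :+ p :* q) := (p :+ q) :* (p :+ q)) refl p q)
    (p≤p+q (+-nonNeg (*-nonNeg 0≤p 0≤q) (*-nonNeg 0≤p 0≤q)))

  ⁴-mono : ∀ {p q} → 0ℚ ℚ.≤ p → p ℚ.≤ q → p ⁴ ℚ.≤ q ⁴
  ⁴-mono 0≤p p≤q = ²-mono (²-nonNeg 0≤p) (²-mono 0≤p p≤q)

  ⁴-superadditive : ∀ {p q} → 0ℚ ℚ.≤ p → 0ℚ ℚ.≤ q → p ⁴ ℚ.+ q ⁴ ℚ.≤ (p ℚ.+ q) ⁴
  ⁴-superadditive 0≤p 0≤q = ℚ.≤-trans (²-superadditive (²-nonNeg 0≤p) (²-nonNeg 0≤q))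
    (²-mono (+-nonNeg (²-nonNeg 0≤p) (²-nonNeg 0≤q)) (²-superadditive 0≤p 0≤q))

  ⁴-pos : ∀ {p} → 0ℚ ℚ.< p → 0ℚ ℚ.< p ⁴
  ⁴-pos 0<p = *-pos (*-pos 0<p 0<p) (*-pos 0<p 0<p)

  grid : ℕ → ℕ → ℚ
  grid k j = (+ j) ℚ./ suc k

  -- root⁴ k q is the fourth root of q ≥ 0 rounded down to a multiple of
  -- 1 / (k + 1): the greatest grid point, up to limit, with fourth power ≤ q
  search : ℕ → ℚ → ℕ → ℚ
  search k q zero    = 0ℚ
  search k q (suc j) = if does (grid k (suc j) ⁴ ℚ.≤? q) then grid k (suc j) else search k q j

  limit : ℕ → ℚ → ℕ
  limit k q = ℤ.∣ ℚ.↥ q ∣ ℕ.* suc k ℕ.+ suc k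

  root⁴ : ℕ → ℚ → ℚ
  root⁴ k q = search k q (limit k q)

  private
    toℚᵘ-grid : ∀ k j → ℚ.toℚᵘ (grid k j) ℚᵘ.≃ ℚᵘ.mkℚᵘ (+ j) k
    toℚᵘ-grid k j = ℚ.toℚᵘ-fromℚᵘ (ℚᵘ.mkℚᵘ (+ j) k)

  grid-nonNeg : ∀ k j → 0ℚ ℚ.≤ grid k j
  grid-nonNeg k j = ℚ.nonNegative⁻¹ (grid k j) {{ℚ.normalize-nonNeg j (suc k)}}

  grid-suc : ∀ k j → grid k (suc j) ≡ grid k j ℚ.+ grid k 1
  grid-suc k j = ℚ.toℚᵘ-injective (begin
    ℚ.toℚᵘ (grid k (suc j))                      ≈⟨ toℚᵘ-grid k (suc j) ⟩
    ℚᵘ.mkℚᵘ (+ suc j) k                          ≈⟨ ℚᵘ.*≡* lem ⟩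
    ℚᵘ.mkℚᵘ (+ j) k ℚᵘ.+ ℚᵘ.mkℚᵘ (+ 1) k         ≈⟨ ℚᵘ.+-cong (toℚᵘ-grid k j) (toℚᵘ-grid k 1) ⟨
    ℚ.toℚᵘ (grid k j) ℚᵘ.+ ℚ.toℚᵘ (grid k 1)     ≈⟨ ℚ.toℚᵘ-homo-+ (grid k j) (grid k 1) ⟨
    ℚ.toℚᵘ (grid k j ℚ.+ grid k 1)               ∎)
    where
    open ℚᵘ.≃-Reasoning
    open import Data.Integer.Solver renaming (module +-*-Solver to S)
    lem : (+ suc j) ℤ.* (+ (suc k ℕ.* suc k)) ≡ ((+ j) ℤ.* (+ suc k) ℤ.+ (+ 1) ℤ.* (+ suc k)) ℤ.* (+ suc k)
    lem = trans (cong ((+ suc j) ℤ.*_) (ℤ.pos-* (suc k) (suc k)))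
      (S.solve 2 (λ j m → (S.con (+ 1) S.:+ j) S.:* (m S.:* m)
        S.:= (j S.:* m S.:+ S.con (+ 1) S.:* m) S.:* m) refl (+ j) (+ suc k))

  grid-anti : ∀ {N k} → N ℕ.≤ k → grid k 1 ℚ.≤ grid N 1
  grid-anti {N} {k} N≤k = ℚ.toℚᵘ-cancel-≤
    (ℚᵘ.≤-respʳ-≃ (ℚᵘ.≃-sym (toℚᵘ-grid N 1)) (ℚᵘ.≤-respˡ-≃ (ℚᵘ.≃-sym (toℚᵘ-grid k 1))
      (ℚᵘ.*≤* (ℤ.*-monoˡ-≤-nonNeg (+ 1) (ℤ.+≤+ (ℕ.s≤s N≤k))))))

  archimedean : ∀ {ε} → 0ℚ ℚ.< ε → ∃[ N ] grid N 1 ℚ.≤ ε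
  archimedean {mkℚ (+ zero) d c}  (ℚ.*<* (ℤ.+<+ ()))
  archimedean {mkℚ -[1+ n ] d c}  (ℚ.*<* ())
  archimedean {mkℚ (+ suc n) d c} _ = d , ℚ.toℚᵘ-cancel-≤
    (ℚᵘ.≤-respˡ-≃ (ℚᵘ.≃-sym (toℚᵘ-grid d 1))
      (ℚᵘ.*≤* (ℤ.*-monoʳ-≤-nonNeg (+ suc d) (ℤ.+≤+ (ℕ.s≤s (ℕ.z≤n {n}))))))

  q<grid : ∀ k q → q ℚ.< grid k (limit k q)
  q<grid k q@(mkℚ n d c) = ℚ.toℚᵘ-cancel-<
    (ℚᵘ.<-respʳ-≃ (ℚᵘ.≃-sym (toℚᵘ-grid k (limit k q))) (ℚᵘ.*<* (lem n)))
    where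
    bound : ∀ m → m ℕ.* suc k ℕ.< (m ℕ.* suc k ℕ.+ suc k) ℕ.* suc d
    bound m = ℕ.<-≤-trans (ℕ.m<m+n (m ℕ.* suc k) {suc k} ℕ.z<s)
      (ℕ.m≤m*n (m ℕ.* suc k ℕ.+ suc k) (suc d))
    lem : ∀ n → n ℤ.* (+ suc k) ℤ.< (+ (ℤ.∣ n ∣ ℕ.* suc k ℕ.+ suc k)) ℤ.* (+ suc d)
    lem (+ m) = subst₂ ℤ._<_ (ℤ.pos-* m (suc k)) (ℤ.pos-* (m ℕ.* suc k ℕ.+ suc k) (suc d))
      (ℤ.+<+ (bound m))
    lem -[1+ m ] = ℤ.-<+

  1≤grid : ∀ k m → 1ℚ ℚ.≤ grid k (m ℕ.+ suc k)
  1≤grid k m = ℚ.toℚᵘ-cancel-≤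
    (ℚᵘ.≤-respʳ-≃ (ℚᵘ.≃-sym (toℚᵘ-grid k (m ℕ.+ suc k))) (ℚᵘ.*≤* lem))
    where
    lem : (+ 1) ℤ.* (+ suc k) ℤ.≤ (+ (m ℕ.+ suc k)) ℤ.* (+ 1)
    lem = subst₂ ℤ._≤_ (sym (ℤ.*-identityˡ (+ suc k))) (sym (ℤ.*-identityʳ _))
      (ℤ.+≤+ (ℕ.m≤n+m (suc k) m))

  p≤p⁴ : ∀ {p} → 1ℚ ℚ.≤ p → p ℚ.≤ p ⁴
  p≤p⁴ {p} 1≤p = ℚ.≤-trans (p≤p² 1≤p) (p≤p² (ℚ.≤-trans 1≤p (p≤p² 1≤p)))
    where
    p≤p² : ∀ {p} → 1ℚ ℚ.≤ p → p ℚ.≤ p ²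
    p≤p² {p} 1≤p = subst (ℚ._≤ p ²) (ℚ.*-identityʳ p)
      (*-monoˡ (ℚ.≤-trans (ℚ.nonNegative⁻¹ 1ℚ) 1≤p) 1≤p)

  if-elim : ∀ {A : Set} (P : ℚ → Set) (d : Dec A) {p q} →
    (A → P p) → (¬ A → P q) → P (if does d then p else q)
  if-elim P (yes a) f g = f a
  if-elim P (no ¬a) f g = g ¬a

  search-nonNeg : ∀ k q j → 0ℚ ℚ.≤ search k q j
  search-nonNeg k q zero = ℚ.≤-refl
  search-nonNeg k q (suc j) = if-elim (0ℚ ℚ.≤_) (grid k (suc j) ⁴ ℚ.≤? q)
    (λ _ → grid-nonNeg k (suc j)) (λ _ → search-nonNeg k q j)

  search-lower : ∀ k q j → 0ℚ ℚ.≤ q → search k q j ⁴ ℚ.≤ q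
  search-lower k q zero 0≤q = 0≤q
  search-lower k q (suc j) 0≤q = if-elim (λ x → x ⁴ ℚ.≤ q) (grid k (suc j) ⁴ ℚ.≤? q)
    (λ p → p) (λ _ → search-lower k q j 0≤q)

  search-upper : ∀ k q j → q ℚ.< grid k (suc j) ⁴ → q ℚ.< (search k q j ℚ.+ grid k 1) ⁴
  search-upper k q zero    h = subst (λ x → q ℚ.< x ⁴) (sym (ℚ.+-identityˡ (grid k 1))) h
  search-upper k q (suc j) h =
    if-elim (λ x → q ℚ.< (x ℚ.+ grid k 1) ⁴) (grid k (suc j) ⁴ ℚ.≤? q)
      (λ _ → subst (λ x → q ℚ.< x ⁴) (grid-suc k (suc j)) h)
      (λ ¬p → search-upper k q j (ℚ.≰⇒> ¬p))

  root⁴-nonNeg : ∀ k q → 0ℚ ℚ.≤ root⁴ k q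
  root⁴-nonNeg k q = search-nonNeg k q (limit k q)

  root⁴-lower : ∀ k q → 0ℚ ℚ.≤ q → root⁴ k q ⁴ ℚ.≤ q
  root⁴-lower k q = search-lower k q (limit k q)

  root⁴-upper : ∀ k q → q ℚ.< (root⁴ k q ℚ.+ grid k 1) ⁴
  root⁴-upper k q = search-upper k q (limit k q) (begin-strict
    q                      <⟨ q<grid k q ⟩
    g                      ≤⟨ p≤p⁴ (1≤grid k (ℤ.∣ ℚ.↥ q ∣ ℕ.* suc k)) ⟩
    g ⁴                    ≤⟨ ⁴-mono {g} {g ℚ.+ grid k 1} (grid-nonNeg k (limit k q)) (p≤p+q (grid-nonNeg k 1)) ⟩
    (g ℚ.+ grid k 1) ⁴     ≡⟨ cong _⁴ (grid-suc k (limit k q)) ⟨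
    grid k (suc (limit k q)) ⁴ ∎)
    where
    open ℚ.≤-Reasoning
    g = grid k (limit k q)

open RationalLemmas hiding (_²)

-- equality of reals is _≈_ below, not _≡_
record ℝ : Set where
  constructor mkℝ
  field
    approx : ℕ → ℚ
    cauchy : ∀ ε → 0ℚ ℚ.< ε →
             ∃[ N ] (∀ i j → N ℕ.≤ i → N ℕ.≤ j → ℚ.∣ approx i ℚ.- approx j ∣ ℚ.≤ ε)

open ℝ public

infix 4 _≤_ _<_ _≈_

_≤_ _<_ _≈_ : ℝ → ℝ → Set
x ≤ y = ∀ ε → 0ℚ ℚ.< ε → ∃[ N ] (∀ i → N ℕ.≤ i → approx x i ℚ.≤ approx y i ℚ.+ ε)
x < y = ∃[ ε ] 0ℚ ℚ.< ε × (∃[ N ] (∀ i → N ℕ.≤ i → approx x i ℚ.+ ε ℚ.≤ approx y i))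
x ≈ y = x ≤ y × y ≤ x

module CauchyLemmas where

  open +-*-Solver using (solve; _:=_; _:+_; _:*_; :-_; _:-_; con)

  OneSided : (ℕ → ℚ) → ℚ → ℕ → Set
  OneSided a ε N = ∀ i j → N ℕ.≤ i → N ℕ.≤ j → a i ℚ.≤ a j ℚ.+ ε

  oneSided : ∀ x ε → 0ℚ ℚ.< ε → ∃[ N ] OneSided (approx x) ε N
  oneSided x ε 0<ε = let N , h = cauchy x ε 0<ε in N , λ i j p q → ∣p-q∣≤ε⇒p≤q+ε (approx x i) (approx x j) (h i j p q)

  fromOneSided : ∀ a → (∀ ε → 0ℚ ℚ.< ε → ∃[ N ] OneSided a ε N) → ℝ
  fromOneSided a f = mkℝ a λ ε 0<ε → let N , h = f ε 0<ε in
    N , λ i j p q → p≤q+ε∧q≤p+ε⇒∣p-q∣≤ε (a i) (a j) (h i j p q) (h j i q p)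

  ⊔ˡ : ∀ {M N i} → M ℕ.⊔ N ℕ.≤ i → M ℕ.≤ i
  ⊔ˡ {M} {N} = ℕ.m⊔n≤o⇒m≤o M N

  ⊔ʳ : ∀ {M N i} → M ℕ.⊔ N ℕ.≤ i → N ℕ.≤ i
  ⊔ʳ {M} {N} = ℕ.m⊔n≤o⇒n≤o M N

  bounded : ∀ x → ∃[ B ] 0ℚ ℚ.< B × (∃[ N ] (∀ i → N ℕ.≤ i → ℚ.∣ approx x i ∣ ℚ.≤ B))
  bounded x = let N , h = cauchy x 1ℚ (ℚ.positive⁻¹ 1ℚ) in
    ℚ.∣ a N ∣ ℚ.+ 1ℚ
    , ℚ.+-mono-≤-< (ℚ.0≤∣p∣ (a N)) (ℚ.positive⁻¹ 1ℚ)
    , N , λ i N≤i → subst (λ p → ℚ.∣ p ∣ ℚ.≤ ℚ.∣ a N ∣ ℚ.+ 1ℚ)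
        (solve 2 (λ p q → q :+ (p :- q) := p) refl (a i) (a N))
        (ℚ.≤-trans (ℚ.∣p+q∣≤∣p∣+∣q∣ (a N) (a i ℚ.- a N))
          (ℚ.+-monoʳ-≤ ℚ.∣ a N ∣ (h i N N≤i ℕ.≤-refl)))
    where a = approx x

  +-oneSided : ∀ x y ε → 0ℚ ℚ.< ε → ∃[ N ] OneSided (λ k → approx x k ℚ.+ approx y k) ε N
  +-oneSided x y ε 0<ε = let
      M , f = oneSided x (half ε) (half-pos 0<ε)
      N , g = oneSided y (half ε) (half-pos 0<ε)
    in M ℕ.⊔ N , λ i j p q →
    subst (approx x i ℚ.+ approx y i ℚ.≤_) (lem (approx x j) (approx y j) (half ε) (half+half ε))
      (ℚ.+-mono-≤ (f i j (⊔ˡ p) (⊔ˡ q)) (g i j (⊔ʳ {M} p) (⊔ʳ {M} q)))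
    where
    lem : ∀ p q h → h ℚ.+ h ≡ ε → (p ℚ.+ h) ℚ.+ (q ℚ.+ h) ≡ (p ℚ.+ q) ℚ.+ ε
    lem p q h refl = solve 3 (λ p q h → (p :+ h) :+ (q :+ h) := (p :+ q) :+ (h :+ h)) refl p q h

  neg-oneSided : ∀ x ε → 0ℚ ℚ.< ε → ∃[ N ] OneSided (λ k → ℚ.- approx x k) ε N
  neg-oneSided x ε 0<ε = let N , f = oneSided x ε 0<ε in N , λ i j p q → +-cancelʳ-≤ (approx x i ℚ.+ approx x j)
    (subst₂ ℚ._≤_
      (solve 2 (λ a b → b := :- a :+ (a :+ b)) refl (approx x i) (approx x j))
      (solve 3 (λ a b e → a :+ e := (:- b :+ e) :+ (a :+ b)) refl (approx x i) (approx x j) ε)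
      (f j i q p))

  ⊔-oneSided : ∀ x y ε → 0ℚ ℚ.< ε → ∃[ N ] OneSided (λ k → approx x k ℚ.⊔ approx y k) ε N
  ⊔-oneSided x y ε 0<ε = let
      M , f = oneSided x ε 0<ε
      N , g = oneSided y ε 0<ε
    in M ℕ.⊔ N , λ i j p q → ℚ.⊔-lub
    (ℚ.≤-trans (f i j (⊔ˡ p) (⊔ˡ q)) (ℚ.+-monoˡ-≤ ε (ℚ.p≤p⊔q (approx x j) (approx y j))))
    (ℚ.≤-trans (g i j (⊔ʳ {M} p) (⊔ʳ {M} q)) (ℚ.+-monoˡ-≤ ε (ℚ.p≤q⊔p (approx x j) (approx y j))))

  *-cauchy : ∀ x y ε → 0ℚ ℚ.< ε → ∃[ N ] (∀ i j → N ℕ.≤ i → N ℕ.≤ j →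
    ℚ.∣ approx x i ℚ.* approx y i ℚ.- approx x j ℚ.* approx y j ∣ ℚ.≤ ε)
  *-cauchy x y ε 0<ε = let
      A , 0<A , M₁ , boundX = bounded x
      B , 0<B , M₂ , boundY = bounded y
      α , 0<α , Aα = scale (half-pos 0<ε) 0<A
      β , 0<β , Bβ = scale (half-pos 0<ε) 0<B
      N₁ , f = cauchy x β 0<β
      N₂ , g = cauchy y α 0<α
      M = M₁ ℕ.⊔ M₂
      N = N₁ ℕ.⊔ N₂
    in M ℕ.⊔ N , λ i j p q → estimate {A} {B} {α} {β} i j 0<A 0<B
      (boundX i (⊔ˡ (⊔ˡ p))) (boundY j (⊔ʳ {M₁} (⊔ˡ q)))
      (f i j (⊔ˡ (⊔ʳ {M} p)) (⊔ˡ (⊔ʳ {M} q)))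
      (g i j (⊔ʳ {N₁} (⊔ʳ {M} p)) (⊔ʳ {N₁} (⊔ʳ {M} q)))
      (trans (cong₂ ℚ._+_ Aα Bβ) (half+half ε))
    where
    open ℚ.≤-Reasoning
    a b : ℕ → ℚ
    a = approx x
    b = approx y
    estimate : ∀ {A B α β} i j → 0ℚ ℚ.< A → 0ℚ ℚ.< B → ℚ.∣ a i ∣ ℚ.≤ A → ℚ.∣ b j ∣ ℚ.≤ B →
      ℚ.∣ a i ℚ.- a j ∣ ℚ.≤ β → ℚ.∣ b i ℚ.- b j ∣ ℚ.≤ α → A ℚ.* α ℚ.+ B ℚ.* β ≡ ε →
      ℚ.∣ a i ℚ.* b i ℚ.- a j ℚ.* b j ∣ ℚ.≤ ε
    estimate {A} {B} {α} {β} i j 0<A 0<B ∣a∣≤A ∣b∣≤B Δa≤β Δb≤α eq = begin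
      ℚ.∣ a i ℚ.* b i ℚ.- a j ℚ.* b j ∣
        ≡⟨ cong ℚ.∣_∣ (solve 4 (λ a b c d →
             a :* b :- c :* d := a :* (b :- d) :+ d :* (a :- c)) refl (a i) (b i) (a j) (b j)) ⟩
      ℚ.∣ a i ℚ.* (b i ℚ.- b j) ℚ.+ b j ℚ.* (a i ℚ.- a j) ∣
        ≤⟨ ℚ.∣p+q∣≤∣p∣+∣q∣ (a i ℚ.* (b i ℚ.- b j)) (b j ℚ.* (a i ℚ.- a j)) ⟩
      ℚ.∣ a i ℚ.* (b i ℚ.- b j) ∣ ℚ.+ ℚ.∣ b j ℚ.* (a i ℚ.- a j) ∣
        ≡⟨ cong₂ ℚ._+_ (ℚ.∣p*q∣≡∣p∣*∣q∣ (a i) (b i ℚ.- b j)) (ℚ.∣p*q∣≡∣p∣*∣q∣ (b j) (a i ℚ.- a j)) ⟩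
      ℚ.∣ a i ∣ ℚ.* ℚ.∣ b i ℚ.- b j ∣ ℚ.+ ℚ.∣ b j ∣ ℚ.* ℚ.∣ a i ℚ.- a j ∣
        ≤⟨ ℚ.+-mono-≤
             (*-mono (ℚ.0≤∣p∣ (b i ℚ.- b j)) (ℚ.<⇒≤ 0<A) ∣a∣≤A Δb≤α)
             (*-mono (ℚ.0≤∣p∣ (a i ℚ.- a j)) (ℚ.<⇒≤ 0<B) ∣b∣≤B Δa≤β) ⟩
      A ℚ.* α ℚ.+ B ℚ.* β
        ≡⟨ eq ⟩
      ε ∎

  -- negative approximations are clipped to 0 before taking roots
  root : ℝ → ℕ → ℚ
  root x k = root⁴ k (0ℚ ℚ.⊔ approx x k)

  0≤clip : ∀ x k → 0ℚ ℚ.≤ 0ℚ ℚ.⊔ approx x k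
  0≤clip x k = ℚ.p≤p⊔q 0ℚ (approx x k)

  clip-oneSided : ∀ x ε → 0ℚ ℚ.< ε → ∃[ N ] OneSided (λ k → 0ℚ ℚ.⊔ approx x k) ε N
  clip-oneSided x ε 0<ε = let N , f = oneSided x ε 0<ε in N , λ i j p q → ℚ.⊔-lub
    (+-nonNeg (0≤clip x j) (ℚ.<⇒≤ 0<ε))
    (ℚ.≤-trans (f i j p q) (ℚ.+-monoˡ-≤ ε (ℚ.p≤q⊔p 0ℚ (approx x j))))

  -- otherwise root x j + ε < root x i, and superadditivity of fourth
  -- powers separates the arguments by more than (ε / 2) ⁴
  root-oneSided : ∀ x ε → 0ℚ ℚ.< ε → ∃[ N ] OneSided (root x) ε N
  root-oneSided x ε 0<ε = let
      M , f = clip-oneSided x (half ε ⁴) (⁴-pos (half-pos 0<ε))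
      N , small = archimedean (half-pos 0<ε)
    in M ℕ.⊔ N , λ i j p q → ℚ.≮⇒≥ λ gap → ℚ.<-irrefl refl
      (separated i j (half ε) (ℚ.<⇒≤ (half-pos 0<ε)) (half+half ε)
        (f i j (⊔ˡ p) (⊔ˡ q)) (ℚ.≤-trans (grid-anti {N} {j} (⊔ʳ {M} q)) small) gap)
    where
    open ℚ.≤-Reasoning
    c : ℕ → ℚ
    c k = 0ℚ ℚ.⊔ approx x k
    separated : ∀ i j h → 0ℚ ℚ.≤ h → h ℚ.+ h ≡ ε → c i ℚ.≤ c j ℚ.+ h ⁴ → grid j 1 ℚ.≤ h →
      root x j ℚ.+ ε ℚ.< root x i → root x i ⁴ ℚ.< root x i ⁴
    separated i j h 0≤h h+h≡ε close small gap = begin-strict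
      root x i ⁴
        ≤⟨ root⁴-lower i (c i) (0≤clip x i) ⟩
      c i
        ≤⟨ close ⟩
      c j ℚ.+ h ⁴
        <⟨ ℚ.+-monoˡ-< (h ⁴) (root⁴-upper j (c j)) ⟩
      (root x j ℚ.+ grid j 1) ⁴ ℚ.+ h ⁴
        ≤⟨ ℚ.+-monoˡ-≤ (h ⁴) (⁴-mono {root x j ℚ.+ grid j 1} {root x j ℚ.+ h}
             (+-nonNeg 0≤r (grid-nonNeg j 1)) (ℚ.+-monoʳ-≤ (root x j) small)) ⟩
      (root x j ℚ.+ h) ⁴ ℚ.+ h ⁴
        ≤⟨ ⁴-superadditive {root x j ℚ.+ h} {h} (+-nonNeg 0≤r 0≤h) 0≤h ⟩
      ((root x j ℚ.+ h) ℚ.+ h) ⁴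
        ≡⟨ cong _⁴ (trans (ℚ.+-assoc (root x j) h h) (cong (root x j ℚ.+_) h+h≡ε)) ⟩
      (root x j ℚ.+ ε) ⁴
        ≤⟨ ⁴-mono {root x j ℚ.+ ε} {root x i}
             (+-nonNeg 0≤r (ℚ.<⇒≤ 0<ε)) (ℚ.<⇒≤ gap) ⟩
      root x i ⁴ ∎
      where 0≤r = root⁴-nonNeg j (c j)

open CauchyLemmas

infix  8 -_
infixl 7 _*_
infixl 6 _+_ _-_ _⊔_
infix  9 _²

fromℚ : ℚ → ℝ
fromℚ q = fromOneSided (λ _ → q) λ ε 0<ε → 0 , λ _ _ _ _ → p≤p+q (ℚ.<⇒≤ 0<ε)

fromℤ : ℤ → ℝ
fromℤ z = fromℚ (z ℚ./ 1)

fromℕ : ℕ → ℝ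
fromℕ m = fromℤ (+ m)

0ℝ 1ℝ : ℝ
0ℝ = fromℕ 0
1ℝ = fromℕ 1

_+_ : ℝ → ℝ → ℝ
x + y = fromOneSided (λ k → approx x k ℚ.+ approx y k) (+-oneSided x y)

-_ : ℝ → ℝ
- x = fromOneSided (λ k → ℚ.- approx x k) (neg-oneSided x)

_-_ : ℝ → ℝ → ℝ
x - y = x + (- y)

_*_ : ℝ → ℝ → ℝ
x * y = mkℝ (λ k → approx x k ℚ.* approx y k) (*-cauchy x y)

_⊔_ : ℝ → ℝ → ℝ
x ⊔ y = fromOneSided (λ k → approx x k ℚ.⊔ approx y k) (⊔-oneSided x y)

∣_∣ : ℝ → ℝ
∣ x ∣ = x ⊔ (- x)

_² : ℝ → ℝ
x ² = x * x

-- the fourth root of x ⊔ 0; see ⁴√-nonNeg and ⁴√-correct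
⁴√ : ℝ → ℝ
⁴√ x = fromOneSided (root x) (root-oneSided x)

⁴√-nonNeg : ∀ x → 0ℝ ≤ ⁴√ x
⁴√-nonNeg x ε 0<ε = 0 , λ i _ →
  +-nonNeg (root⁴-nonNeg i (0ℚ ℚ.⊔ approx x i)) (ℚ.<⇒≤ 0<ε)

⁴√-correct : ∀ x → 0ℝ ≤ x → ((⁴√ x) ²) ² ≈ x
⁴√-correct x 0≤x = lower , upper
  where
  open +-*-Solver using (solve; _:=_; _:+_; _:*_)
  open RationalLemmas using () renaming (_² to _²ℚ)

  c : ℕ → ℚ
  c k = 0ℚ ℚ.⊔ approx x k

  lower : ((⁴√ x) ²) ² ≤ x
  lower ε 0<ε = let N , h = 0≤x ε 0<ε in N , λ i N≤i → ℚ.≤-trans (root⁴-lower i (c i) (0≤clip x i))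
    (ℚ.⊔-lub {approx x i ℚ.+ ε} {0ℚ} {approx x i} (h i N≤i) (p≤p+q {approx x i} (ℚ.<⇒≤ 0<ε)))

  ²-modulus : ∀ {r B h H} → 0ℚ ℚ.≤ h → r ℚ.≤ B → h ℚ.≤ H →
    (r ℚ.+ h) ²ℚ ℚ.≤ r ²ℚ ℚ.+ h ℚ.* (B ℚ.+ B ℚ.+ H)
  ²-modulus {r} {B} {h} {H} 0≤h r≤B h≤H = subst (ℚ._≤ r ²ℚ ℚ.+ h ℚ.* (B ℚ.+ B ℚ.+ H))
    (solve 2 (λ r h → r :* r :+ h :* (r :+ r :+ h) := (r :+ h) :* (r :+ h)) refl r h)
    (ℚ.+-monoʳ-≤ (r ²ℚ) (*-monoˡ 0≤h (ℚ.+-mono-≤ (ℚ.+-mono-≤ r≤B r≤B) h≤H)))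

  upper : x ≤ ((⁴√ x) ²) ²
  upper ε 0<ε = let
      B , 0<B , M , boundR = bounded (⁴√ x)
      η , 0<η , Cη = scale 0<ε (0<C 0<B)
      N , small = archimedean 0<η
    in N ℕ.⊔ M , λ i p → estimate i 0<B
      (ℚ.≤-trans (p≤∣p∣ (root x i)) (boundR i (⊔ʳ {N} p)))
      (ℚ.≤-trans (grid-anti {N} {i} (⊔ˡ p)) small) Cη
    where
    open ℚ.≤-Reasoning
    D C : ℚ → ℚ
    D B = B ℚ.+ B ℚ.+ 1ℚ
    C B = D B ℚ.* (B ²ℚ ℚ.+ B ²ℚ ℚ.+ 1ℚ ℚ.* D B)
    0<D : ∀ {B} → 0ℚ ℚ.< B → 0ℚ ℚ.< D B
    0<D 0<B = ℚ.+-mono-< (ℚ.+-mono-< 0<B 0<B) (ℚ.positive⁻¹ 1ℚ)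
    0<C : ∀ {B} → 0ℚ ℚ.< B → 0ℚ ℚ.< C B
    0<C 0<B = *-pos (0<D 0<B) (ℚ.+-mono-< (ℚ.+-mono-< (*-pos 0<B 0<B) (*-pos 0<B 0<B))
      (*-pos (ℚ.positive⁻¹ 1ℚ) (0<D 0<B)))
    estimate : ∀ {B η} i → 0ℚ ℚ.< B → root x i ℚ.≤ B → grid i 1 ℚ.≤ η → C B ℚ.* η ≡ ε →
      approx x i ℚ.≤ root x i ⁴ ℚ.+ ε
    estimate {B} {η} i 0<B r≤B h≤η Cη = begin
      approx x i
        ≤⟨ ℚ.p≤q⊔p 0ℚ (approx x i) ⟩
      c i
        ≤⟨ ℚ.<⇒≤ (root⁴-upper i (c i)) ⟩
      (r ℚ.+ h) ⁴
        ≤⟨ ²-mono (²-nonNeg (+-nonNeg 0≤r 0≤h)) (²-modulus {r} {B} {h} {1ℚ} 0≤h r≤B h≤1) ⟩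
      (r ²ℚ ℚ.+ h ℚ.* D B) ²ℚ
        ≤⟨ ²-modulus {r ²ℚ} {B ²ℚ} {h ℚ.* D B} {1ℚ ℚ.* D B} (*-nonNeg 0≤h 0≤D) (²-mono 0≤r r≤B)
             (ℚ.*-monoʳ-≤-nonNeg (D B) {{ℚ.nonNegative 0≤D}} h≤1) ⟩
      r ⁴ ℚ.+ h ℚ.* D B ℚ.* (B ²ℚ ℚ.+ B ²ℚ ℚ.+ 1ℚ ℚ.* D B)
        ≡⟨ cong (r ⁴ ℚ.+_) (trans (ℚ.*-assoc h (D B) _) (ℚ.*-comm h (C B))) ⟩
      r ⁴ ℚ.+ C B ℚ.* h
        ≤⟨ ℚ.+-monoʳ-≤ (r ⁴) (*-monoˡ (ℚ.<⇒≤ (0<C 0<B)) h≤η) ⟩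
      r ⁴ ℚ.+ C B ℚ.* η
        ≡⟨ cong (r ⁴ ℚ.+_) Cη ⟩
      r ⁴ ℚ.+ ε ∎
      where
      r = root x i
      h = grid i 1
      0≤h = grid-nonNeg i 1
      0≤r = root⁴-nonNeg i (c i)
      0≤D = ℚ.<⇒≤ (0<D 0<B)
      h≤1 : h ℚ.≤ 1ℚ
      h≤1 = grid-anti {0} {i} ℕ.z≤n

+-0-rawMonoid : RawMonoid 0ℓ 0ℓ
+-0-rawMonoid = record { Carrier = ℝ ; _≈_ = _≈_ ; _∙_ = _+_ ; ε = 0ℝ }

open RawMonoidDefinitions +-0-rawMonoid public using (sum)

record Point (n : ℕ) : Set where
  constructor ⟨_,_⟩
  field
    horizontal : Vector ℝ (n ℕ.+ n)
    vertical   : ℝ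

kronecker : ∀ {n} → Fin n → Fin n → ℝ
kronecker i j = if does (i ≟ᶠ j) then 1ℝ else 0ℝ

J : ∀ n → Fin (n ℕ.+ n) → Fin (n ℕ.+ n) → ℝ
J n i j with splitAt n i | splitAt n j
... | inj₁ _ | inj₁ _ = 0ℝ
... | inj₁ a | inj₂ b = kronecker a b
... | inj₂ a | inj₁ b = - kronecker a b
... | inj₂ _ | inj₂ _ = 0ℝ

symplectic : ∀ n → Vector ℝ (n ℕ.+ n) → Vector ℝ (n ℕ.+ n) → ℝ
symplectic n x y = sum λ i → sum λ j → x i * J n i j * y j

infixl 7 _∗_

_∗_ : ∀ {n} → Point n → Point n → Point n
_∗_ {n} ⟨ x , s ⟩ ⟨ y , t ⟩ = ⟨ (λ i → x i + y i) , s + t + fromℚ ½ * symplectic n x y ⟩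

_⁻¹ : ∀ {n} → Point n → Point n
⟨ y , t ⟩ ⁻¹ = ⟨ (λ i → - y i) , - t ⟩

-- the square of the Euclidean norm; ∣ x ∣⁴ is then a polynomial, ∣ x ∣² ²
∣_∣² : ∀ {m} → Vector ℝ m → ℝ
∣ x ∣² = sum λ i → x i ²

‖_‖₄ : ∀ {n} → Point n → ℝ
‖ ⟨ x , s ⟩ ‖₄ = ⁴√ (∣ x ∣² ² + fromℕ 16 * s ²)

φ₄ : ∀ {n} → Point n → Point n → ℝ
φ₄ x y = ‖ x ∗ y ⁻¹ ‖₄

-- ℤ^D, split as ℤ^2n × ℤ; plain data, so that _≡_ is the right equality
record LatticePoint (n : ℕ) : Set where
  constructor ⟨_,_⟩
  field
    horizontal : Vec ℤ (n ℕ.+ n)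
    vertical   : ℤ

⟦_⟧ : ∀ {n} → LatticePoint n → Point n
⟦ ⟨ b , z ⟩ ⟧ = ⟨ (λ i → fromℤ (lookup b i)) , fromℤ z ⟩

_∈L[_,_] : ∀ {n} → LatticePoint n → ℝ → ℕ → Set
⟨ b , z ⟩ ∈L[ c , Q ] =
  (∀ i → ∣ fromℤ (lookup b i) ∣ ≤ c * fromℕ Q) × ∣ fromℤ z ∣ ≤ c * fromℕ (Q ℕ.^ 2)

ClosePair : ∀ n → ℝ → ℝ → ℕ → LatticePoint n × LatticePoint n → Set
ClosePair n c δ Q (u , v) =
  u ∈L[ c , Q ] × v ∈L[ c , Q ] × ∣ φ₄ ⟦ u ⟧ ⟦ v ⟧ - fromℕ Q ∣ ≤ δ

infix 4 _·#_≤_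

-- a · #P ≤ b for a ≥ 0. Order on ℝ is undecidable, so the cardinality of a set
-- cut out by real inequalities is not available as a natural number; instead
-- every finite family of distinct elements of P is counted.
_·#_≤_ : {A : Set} → ℝ → (A → Set) → ℝ → Set
a ·# P ≤ b = ∀ xs → Unique xs → All P xs → a * fromℕ (length xs) ≤ b

-- Q to the power - k
_^-_ : (Q : ℕ) .{{_ : NonZero Q}} → ℕ → ℝ
Q ^- k = fromℚ ((+ 1 ℚ./ (Q ℕ.^ k)) {{ℕ.m^n≢0 Q k}})

{-# OPTIONS --safe #-}

-- Write a for the horizontal part of u ∗ v ⁻¹ and z / 2 for its vertical part; a and z are integral and
-- φ₄ (u , v) ^ 4 is the natural number N = |a|⁴ + 4 z². As u is determined by v, a and z, it suffices to fix
-- v in the box and to count the pairs (a , z). If T is an integer with T ≈ Q δ + O(1), the condition on φ₄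
-- puts N within O(T Q²) of Q⁴, so N lies in one of O(T) layers κ Q² ≤ N < (κ + 1) Q². Fixing the layer, the
-- signs and all coordinates of a but one leaves pairs (x , m) of naturals with
-- κ Q² ≤ (x² + s)² + 4 m² < (κ + 1) Q², and there are O(Q) of these. Where m is of order Q², each x admits
-- boundedly many m. Elsewhere x² + s is of order Q²; if r is the largest x, the values of m over x = r - i
-- have diameter d with d² i r = O(Q²), and these diameters add up to O(Q) since ∑_{i ≤ r} (i r)^(-1/2) ≤ 2.

module Submission where

-- Counting by lists of distinct elements.

module Counting where

  open import Data.Empty using (⊥-elim)
  open import Data.List.Base using ([]; _∷_; length; map; filter; deduplicate)
  open import Data.List.Extrema.Nat using (argmin; argmax; argmin-all; argmax-all;
    f[argmin]≤f[⊤]; f[argmin]≤f[xs]; f[⊥]≤f[argmax]; f[xs]≤f[argmax])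
  open import Data.List.Membership.Propositional using (_∈_)
  open import Data.List.Membership.Propositional.Properties using (∈-map⁺; ∈-deduplicate⁺; ∈-deduplicate⁻; ∈-map⁻)
  open import Data.List.Properties using (length-map; filter-all; filter-≐)
  open import Data.List.Relation.Unary.All as All using (All; []; _∷_)
  import Data.List.Relation.Unary.All.Properties as All
  open import Data.List.Relation.Unary.AllPairs using ([]; _∷_)
  open import Data.List.Relation.Unary.Any using (here; there)
  open import Data.List.Relation.Unary.Unique.Propositional using (Unique)
  import Data.List.Relation.Unary.Unique.Propositional.Properties as Unique
  open import Data.List.Relation.Unary.Unique.DecPropositional.Properties using (deduplicate-!)
  open import Data.Nat.Base using (ℕ; zero; suc; _+_; _*_; _∸_; _≤_; _<_; z≤n; s≤s; s≤s⁻¹)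
  open import Data.Nat.Properties
  open import Data.Product.Base using (_×_; _,_; proj₁; proj₂; ∃-syntax)
  open import Data.Sum.Base as Sum using (_⊎_; [_,_]′)
  open import Function.Base using (_∘_)
  open import Relation.Binary.Definitions using (DecidableEquality)
  open import Relation.Binary.PropositionalEquality
  open import Relation.Nullary using (¬_; yes; no; ¬?)
  open import Relation.Unary using (Decidable)

  private variable
    A B : Set
    k l m : ℕ

  -- The analogue of `_·#_≤_` over the naturals: families of distinct elements stand in for a
  -- cardinality, so `P` may be undecidable.
  AtMost : ℕ → (A → Set) → Set
  AtMost k P = ∀ xs → Unique xs → All P xs → length xs ≤ k

  unique-map : {P : A → Set} (f : A → B) → (∀ {x y} → P x → P y → f x ≡ f y → x ≡ y) →
    ∀ {xs} → All P xs → Unique xs → Unique (map f xs)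
  unique-map f inj []         []         = []
  unique-map f inj (px ∷ pxs) (x∉xs ∷ u) =
    All.map⁺ (All.zipWith (λ (py , x≢y) → x≢y ∘ inj px py) (pxs , x∉xs)) ∷ unique-map f inj pxs u

  length-filter-∁ : {D : A → Set} (D? : Decidable D) → ∀ xs →
    length xs ≡ length (filter D? xs) + length (filter (¬? ∘ D?) xs)
  length-filter-∁ D? []       = refl
  length-filter-∁ D? (x ∷ xs) with D? x
  ... | yes _ = cong suc (length-filter-∁ D? xs)
  ... | no  _ = trans (cong suc (length-filter-∁ D? xs)) (sym (+-suc _ _))

  atMost-⊆ : {P Q : A → Set} → (∀ {x} → P x → Q x) → AtMost k Q → AtMost k P
  atMost-⊆ P⊆Q h xs u pxs = h xs u (All.map P⊆Q pxs)

  atMost-≤ : {P : A → Set} → k ≤ l → AtMost k P → AtMost l P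
  atMost-≤ k≤l h xs u pxs = ≤-trans (h xs u pxs) k≤l

  atMost-injective : {P : A → Set} {R : B → Set} (f : A → B) →
    (∀ {x y} → P x → P y → f x ≡ f y → x ≡ y) → (∀ {x} → P x → R (f x)) →
    AtMost k R → AtMost k P
  atMost-injective f inj P⇒R h xs u pxs = subst (_≤ _) (length-map f xs)
    (h (map f xs) (unique-map f inj pxs u) (All.map⁺ (All.map P⇒R pxs)))

  atMost-split : {P D : A → Set} (D? : Decidable D) →
    AtMost k (λ x → P x × D x) → AtMost l (λ x → P x × ¬ D x) → AtMost (k + l) P
  atMost-split D? h₁ h₂ xs u pxs = subst (_≤ _) (sym (length-filter-∁ D? xs)) (+-mono-≤
    (h₁ (filter D? xs) (Unique.filter⁺ D? u)
      (All.zip (All.filter⁺ D? pxs , All.all-filter D? xs)))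
    (h₂ (filter (¬? ∘ D?) xs) (Unique.filter⁺ (¬? ∘ D?) u)
      (All.zip (All.filter⁺ (¬? ∘ D?) pxs , All.all-filter (¬? ∘ D?) xs))))

  -- The deduplicated values of `g` on the list are a family in `R`, so there are at most `m` of
  -- them; `go` removes the fibre over one value at a time, at a cost of at most `k` each.
  atMost-fibres : {P : A → Set} {R : B → Set} → DecidableEquality B → (g : A → B) →
    (∀ {x} → P x → R (g x)) → AtMost m R → (∀ y → AtMost k (λ x → P x × g x ≡ y)) →
    AtMost (m * k) P
  atMost-fibres {k = k} {P} {R} _≟_ g P⇒R hR fibre xs u pxs = ≤-trans
    (go ys xs u (All.tabulate λ x∈xs → All.lookup pxs x∈xs , ∈-deduplicate⁺ _≟_ (∈-map⁺ g x∈xs)))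
    (*-monoˡ-≤ k (hR ys (deduplicate-! _≟_ (map g xs)) (All.tabulate R-ys)))
    where
    ys = deduplicate _≟_ (map g xs)
    R-ys : ∀ {y} → y ∈ ys → R y
    R-ys y∈ys with ∈-map⁻ g (∈-deduplicate⁻ _≟_ (map g xs) y∈ys)
    ... | x , x∈xs , refl = P⇒R (All.lookup pxs x∈xs)
    later : ∀ {x y zs} → (P x × g x ∈ y ∷ zs) × ¬ g x ≡ y → P x × g x ∈ zs
    later ((px , here eq)  , neq) = ⊥-elim (neq eq)
    later ((px , there i) , _)   = px , i
    go : ∀ zs → AtMost (length zs * k) (λ x → P x × g x ∈ zs)
    go []       []      _ _                = z≤n
    go []       (_ ∷ _) _ ((_ , ()) ∷ _)
    go (z ∷ zs) = atMost-split (λ x → g x ≟ z)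
      (atMost-⊆ (λ ((px , _) , eq) → px , eq) (fibre z)) (atMost-⊆ later (go zs))

  atMost-× : {R : A → Set} {S : B → Set} → DecidableEquality A →
    AtMost m R → AtMost k S → AtMost (m * k) (λ (x , y) → R x × S y)
  atMost-× _≟_ hR hS = atMost-fibres _≟_ proj₁ proj₁ hR λ _ →
    atMost-injective proj₂ (λ { (_ , refl) (_ , refl) refl → refl }) (λ ((_ , s) , _) → s) hS

  atMost-≡ : (a : A) → AtMost 1 (_≡ a)
  atMost-≡ a []          _                   _                  = z≤n
  atMost-≡ a (_ ∷ [])    _                   _                  = ≤-refl
  atMost-≡ a (_ ∷ _ ∷ _) ((x≢y ∷ _) ∷ _) (refl ∷ refl ∷ _) = ⊥-elim (x≢y refl)

  atMost-< : ∀ m → AtMost m (_< m)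
  atMost-< zero    []      _ _        = z≤n
  atMost-< zero    (_ ∷ _) _ (() ∷ _)
  atMost-< (suc m) = atMost-split (_≟ m) (atMost-⊆ proj₂ (atMost-≡ m))
    (atMost-⊆ (λ (x≤m , x≢m) → ≤∧≢⇒< (s≤s⁻¹ x≤m) x≢m) (atMost-< m))

  atMost-interval : ∀ a k → AtMost k (λ x → a ≤ x × x < a + k)
  atMost-interval a k = atMost-injective (_∸ a)
    (λ (a≤x , _) (a≤y , _) → ∸-cancelʳ-≡ a≤x a≤y)
    (λ {x} (a≤x , x<a+k) → subst (x ∸ a <_) (m+n∸m≡n a k) (∸-monoˡ-< x<a+k a≤x))
    (atMost-< k)

  -- Pigeonhole: the values of `f` on the list are distinct and lie between those at `lo` and `hi`.
  -- A count thus becomes a gap between two elements, to which the geometry of `P` applies.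
  spread : {P : A → Set} (f : A → ℕ) → (∀ {x y} → P x → P y → f x ≡ f y → x ≡ y) →
    ∀ xs → Unique xs → All P xs → 0 < length xs →
    ∃[ x ] ∃[ y ] P x × P y × f x + (length xs ∸ 1) ≤ f y
  spread f inj (x ∷ xs) u pxs@(p ∷ ps) _ = lo , hi , argmin-all f p ps , argmax-all f p ps ,
    (begin
      f lo + length xs   ≤⟨ +-monoʳ-≤ (f lo) (s≤s⁻¹ count) ⟩
      f lo + (f hi ∸ f lo) ≡⟨ m+[n∸m]≡n f-lo≤f-hi ⟩
      f hi                 ∎)
    where
    open ≤-Reasoning
    lo = argmin f x xs
    hi = argmax f x xs
    f-lo≤f-hi : f lo ≤ f hi
    f-lo≤f-hi = ≤-trans (f[argmin]≤f[⊤] {f = f} x xs) (f[⊥]≤f[argmax] {f = f} x xs)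
    above : ∀ {y} → f lo ≤ f y × f y ≤ f hi → f lo ≤ f y × f y < f lo + suc (f hi ∸ f lo)
    above {y} (l , h) = l , subst (f y <_)
      (trans (cong suc (sym (m+[n∸m]≡n f-lo≤f-hi))) (sym (+-suc (f lo) _))) (s≤s h)
    count : length (x ∷ xs) ≤ suc (f hi ∸ f lo)
    count = subst (_≤ suc (f hi ∸ f lo)) (length-map f (x ∷ xs))
      (atMost-interval (f lo) (suc (f hi ∸ f lo)) (map f (x ∷ xs)) (unique-map f inj pxs u)
        (All.map⁺ (All.map above ((f[argmin]≤f[⊤] {f = f} x xs , f[⊥]≤f[argmax] {f = f} x xs) ∷
          All.zip (f[argmin]≤f[xs] {f = f} x xs , f[xs]≤f[argmax] {f = f} x xs)))))

  -- Starts at 1: in the sum of `(i r)^(-1/2)` that it models, the term at 0 would be infinite.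
  Σ₁ : ℕ → (ℕ → ℕ) → ℕ
  Σ₁ zero    f = 0
  Σ₁ (suc r) f = Σ₁ r f + f (suc r)

  length-filter-⊎ : {D E F : A → Set} (D? : Decidable D) (E? : Decidable E) (F? : Decidable F) →
    (∀ {x} → D x → E x ⊎ F x) → (∀ {x} → E x → D x) → (∀ {x} → F x → D x × ¬ E x) →
    ∀ xs → length (filter D? xs) ≡ length (filter E? xs) + length (filter F? xs)
  length-filter-⊎ D? E? F? D⇒ E⇒D F⇒D []       = refl
  length-filter-⊎ D? E? F? D⇒ E⇒D F⇒D (x ∷ xs)
    with D? x | E? x | F? x | length-filter-⊎ D? E? F? D⇒ E⇒D F⇒D xs
  ... | yes d | yes e | yes f | _  = ⊥-elim (proj₂ (F⇒D f) e)
  ... | yes d | yes e | no ¬f | ih = cong suc ih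
  ... | yes d | no ¬e | yes f | ih = trans (cong suc ih) (sym (+-suc _ _))
  ... | yes d | no ¬e | no ¬f | _  = ⊥-elim ([ ¬e , ¬f ]′ (D⇒ d))
  ... | no ¬d | yes e | _     | _  = ⊥-elim (¬d (E⇒D e))
  ... | no ¬d | no ¬e | yes f | _  = ⊥-elim (¬d (proj₁ (F⇒D f)))
  ... | no ¬d | no ¬e | no ¬f | ih = ih

  -- Keeps the size of each single fibre, where `atMost-fibres` has one bound for all; the rows in
  -- `flat-count` have bounds that vary with `i`.
  length-fibres : (g : A → ℕ) → ∀ r xs → All (λ x → g x ≤ r) xs →
    let size i = length (filter (λ x → g x ≟ i) xs) in length xs ≡ size 0 + Σ₁ r size
  length-fibres g r xs h =
    trans (sym (cong length (filter-all (λ x → g x ≤? r) h))) (go r)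
    where
    size : ℕ → ℕ
    size i = length (filter (λ x → g x ≟ i) xs)
    go : ∀ r → length (filter (λ x → g x ≤? r) xs) ≡ size 0 + Σ₁ r size
    go zero    = trans (cong length (filter-≐ (λ x → g x ≤? 0) (λ x → g x ≟ 0) (n≤0⇒n≡0 , ≤-reflexive) xs))
      (sym (+-identityʳ (size 0)))
    go (suc r) = trans (length-filter-⊎ (λ x → g x ≤? suc r) (λ x → g x ≤? r) (λ x → g x ≟ suc r)
      (λ p → Sum.map₁ s≤s⁻¹ (m≤n⇒m<n∨m≡n p)) m≤n⇒m≤1+n
      (λ p → ≤-reflexive p , <⇒≱ (≤-reflexive (sym p))) xs)
      (trans (cong (_+ size (suc r)) (go r)) (+-assoc (size 0) _ _))

-- Lattice points in one layer of the quartic `(x² + s)² + 4 m²`.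

module Planar where

  open import Data.List.Base using ([]; _∷_; length; filter)
  open import Data.List.Extrema.Nat using (argmax; argmax-all; f[⊥]≤f[argmax]; f[xs]≤f[argmax])
  open import Data.List.Relation.Unary.All as All using (All; []; _∷_)
  import Data.List.Relation.Unary.All.Properties as All
  import Data.List.Relation.Unary.Unique.Propositional.Properties as Unique
  open import Data.Nat.Base
  open import Data.Nat.Properties
  open import Data.Nat.Tactic.RingSolver using (solve-∀)
  open import Data.Product.Base using (_×_; _,_; proj₁; proj₂)
  open import Relation.Binary.PropositionalEquality
  open import Relation.Nullary using (¬_; yes; no; contradiction)
  open Counting

  ≤-by : ∀ {a b} c → a + c ≡ b → a ≤ b
  ≤-by {a} c eq = subst (a ≤_) eq (m≤m+n a c)

  square-cancel-≤ : ∀ {a b} → a * a ≤ b * b → a ≤ b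
  square-cancel-≤ {a} {b} h with a ≤? b
  ... | yes a≤b = a≤b
  ... | no  a≰b = contradiction h (<⇒≱ (*-mono-< (≰⇒> a≰b) (≰⇒> a≰b)))

  open ≤-Reasoning

  -- The discrete form of ∑_{i ≤ r} P / √(i r) ≤ 2 P.
  Σ₁-√-bound : ∀ (f : ℕ → ℕ) P r → (∀ i → 1 ≤ i → i ≤ r → f i * f i * (i * r) ≤ P * P) →
    Σ₁ r f ≤ 2 * P
  Σ₁-√-bound f P zero    h = z≤n
  Σ₁-√-bound f P r@(suc _) h = square-cancel-≤ (*-cancelʳ-≤ _ _ r (begin
      Σ₁ r f * Σ₁ r f * r   ≤⟨ go r ≤-refl ⟩
      4 * (P * P) * r       ≡⟨ cong (_* r) (double P) ⟩
      2 * P * (2 * P) * r   ∎))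
    where
    double : ∀ P → 4 * (P * P) ≡ 2 * P * (2 * P)
    double = solve-∀
    -- With `S` the partial sum, the invariant is the square of `S ≤ 2 P √(k / r)`. The inductive
    -- step is multiplied by `k + 1` so that the hypothesis on `f (k + 1)` applies to the last term
    -- as it stands.
    go : ∀ k → k ≤ r → Σ₁ k f * Σ₁ k f * r ≤ 4 * (P * P) * k
    go zero    _   = z≤n
    go (suc k) k<r = *-cancelˡ-≤ (suc k) (begin
      suc k * ((S + g) * (S + g) * r)
        ≡⟨ expand k S g r ⟩
      suc k * (S * S * r) + 2 * (suc k * (S * g * r)) + g * g * (suc k * r)
        ≤⟨ +-mono-≤ (+-mono-≤ (*-monoʳ-≤ (suc k) ih) (*-monoʳ-≤ 2 cross)) hg ⟩
      suc k * (4 * (P * P) * k) + 2 * (P * P * (2 * k + 1)) + P * P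
        ≤⟨ ≤-by (P * P) (collect k (P * P)) ⟩
      suc k * (4 * (P * P) * suc k) ∎)
      where
      S = Σ₁ k f
      g = f (suc k)
      ih = go k (<⇒≤ k<r)
      hg : g * g * (suc k * r) ≤ P * P
      hg = h (suc k) (s≤s z≤n) k<r
      expand : ∀ k S g r → suc k * ((S + g) * (S + g) * r) ≡
        suc k * (S * S * r) + 2 * (suc k * (S * g * r)) + g * g * (suc k * r)
      expand = solve-∀
      collect : ∀ k p → suc k * (4 * p * k) + 2 * (p * (2 * k + 1)) + p + p ≡ suc k * (4 * p * suc k)
      collect = solve-∀
      regroup : ∀ k S g r → suc k * (S * g * r) * (suc k * (S * g * r)) ≡
        suc k * (S * S * r * (g * g * (suc k * r)))
      regroup = solve-∀
      am-gm : ∀ k p → suc k * (4 * p * k * p) + p * p ≡ p * (2 * k + 1) * (p * (2 * k + 1))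
      am-gm = solve-∀
      -- The geometric mean of `ih` and `hg`; `4 k (k + 1) ≤ (2 k + 1)²` removes the root.
      cross : suc k * (S * g * r) ≤ P * P * (2 * k + 1)
      cross = square-cancel-≤ (begin
        suc k * (S * g * r) * (suc k * (S * g * r))   ≡⟨ regroup k S g r ⟩
        suc k * (S * S * r * (g * g * (suc k * r)))   ≤⟨ *-monoʳ-≤ (suc k) (*-mono-≤ ih hg) ⟩
        suc k * (4 * (P * P) * k * (P * P))           ≤⟨ ≤-by (P * P * (P * P)) (am-gm k (P * P)) ⟩
        P * P * (2 * k + 1) * (P * P * (2 * k + 1))   ∎)

  Σ₁-mono : ∀ {f g : ℕ → ℕ} r → (∀ i → f i ≤ g i) → Σ₁ r f ≤ Σ₁ r g
  Σ₁-mono zero    h = z≤n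
  Σ₁-mono (suc r) h = +-mono-≤ (Σ₁-mono r h) (h (suc r))

  Σ₁-suc : ∀ r f → Σ₁ r (λ i → suc (f i)) ≡ r + Σ₁ r f
  Σ₁-suc zero    f = refl
  Σ₁-suc (suc r) f = trans (cong (_+ suc (f (suc r))) (Σ₁-suc r f)) (lem r (Σ₁ r f) (f (suc r)))
    where
    lem : ∀ r s t → r + s + suc t ≡ suc r + (s + t)
    lem = solve-∀

  -- By `spread`, among `e + 1` elements there are two whose values under `f` are at least `e`
  -- apart.
  atMost-diameter : {A : Set} {P : A → Set} (f : A → ℕ) (d : ℕ) →
    (∀ {x y} → P x → P y → f x ≡ f y → x ≡ y) →
    (∀ {x y} e → P x → P y → f x + e ≤ f y → e ≤ d) → AtMost (suc d) P
  atMost-diameter f d inj h []          _ _   = z≤n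
  atMost-diameter f d inj h xs@(_ ∷ xs′) u pxs =
    let x , y , px , py , gap = spread f inj xs u pxs (s≤s z≤n) in s≤s (h (length xs′) px py gap)

  quartic : ℕ → ℕ × ℕ → ℕ
  quartic s (x , m) = (x * x + s) * (x * x + s) + 4 * (m * m)

  -- `lower` and `upper` select the layer `κ`, of thickness `Q²`; `large` and `small` make the
  -- quartic comparable with `Q⁴`, with constants independent of `κ`.
  record Shell (Q κ s : ℕ) (p : ℕ × ℕ) : Set where
    field
      lower : κ * (Q * Q) ≤ quartic s p
      upper : quartic s p < κ * (Q * Q) + Q * Q
      large : Q * Q * (Q * Q) ≤ 8 * (quartic s p + 1)
      small : quartic s p ≤ 16 * (Q * Q * (Q * Q))

  open Shell

  module _ {Q κ s : ℕ} where

    private q = Q * Q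

    -- Both points have the same `x`, so `(x² + s)²` cancels and the thickness of the layer bounds
    -- `4 m′² - 4 m²`, which is at least `4 d (2 m + d)`.
    gap : ∀ {x m m′} d → Shell Q κ s (x , m) → Shell Q κ s (x , m′) → m + d ≤ m′ →
      4 * (d * (2 * m + d)) < q
    gap {x} {m} {m′} d p p′ m+d≤m′ = +-cancelˡ-< (κ * q) _ _ (begin-strict
      κ * q + 4 * (d * (2 * m + d))                 ≤⟨ +-monoˡ-≤ _ (lower p) ⟩
      y * y + 4 * (m * m) + 4 * (d * (2 * m + d))   ≡⟨ complete (y * y) m d ⟩
      y * y + 4 * ((m + d) * (m + d))
        ≤⟨ +-monoʳ-≤ (y * y) (*-monoʳ-≤ 4 (*-mono-≤ m+d≤m′ m+d≤m′)) ⟩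
      y * y + 4 * (m′ * m′)                         <⟨ upper p′ ⟩
      κ * q + q                                     ∎)
      where
      y = x * x + s
      complete : ∀ a m d → a + 4 * (m * m) + 4 * (d * (2 * m + d)) ≡ a + 4 * ((m + d) * (m + d))
      complete = solve-∀

    x≤2Q : ∀ {x m} → Shell Q κ s (x , m) → x ≤ 2 * Q
    x≤2Q {x} {m} p = square-cancel-≤ (square-cancel-≤ (begin
      x * x * (x * x)                             ≤⟨ *-mono-≤ (m≤m+n (x * x) s) (m≤m+n (x * x) s) ⟩
      (x * x + s) * (x * x + s)                   ≤⟨ m≤m+n _ _ ⟩
      quartic s (x , m)                           ≤⟨ small p ⟩
      16 * (q * q)                                ≡⟨ lem Q ⟩
      2 * Q * (2 * Q) * (2 * Q * (2 * Q))         ∎))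
      where
      lem : ∀ Q → 16 * (Q * Q * (Q * Q)) ≡ 2 * Q * (2 * Q) * (2 * Q * (2 * Q))
      lem = solve-∀

    -- These record which of `m` and `x² + s` has order `Q²`. The constants 12 and 6 are large
    -- enough for every point of a shell to satisfy one of the two conditions.
    Steep Flat : ℕ × ℕ → Set
    Steep (x , m) = q ≤ 12 * (m + 1)
    Flat  (x , m) = q ≤ 6 * (x * x + s + 1)

    -- If both fail, `2 q²` is at least `36 (y + 1)² + 144 (m + 1)²`, whereas twice `large` makes it
    -- at most `16 (y² + 4 m² + 1)`.
    ¬Steep⇒Flat : ∀ {p} → Shell Q κ s p → ¬ Steep p → Flat p
    ¬Steep⇒Flat {x , m} p ¬steep with q ≤? 6 * (x * x + s + 1)
    ... | yes flat  = flat
    ... | no  ¬flat = contradiction (begin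
        36 * ((y + 1) * (y + 1)) + 144 * ((m + 1) * (m + 1))
          ≡⟨ squares y m ⟩
        6 * (y + 1) * (6 * (y + 1)) + 12 * (m + 1) * (12 * (m + 1))
          ≤⟨ +-mono-≤ (*-mono-≤ (<⇒≤ (≰⇒> ¬flat)) (<⇒≤ (≰⇒> ¬flat)))
               (*-mono-≤ (<⇒≤ (≰⇒> ¬steep)) (<⇒≤ (≰⇒> ¬steep))) ⟩
        q * q + q * q
          ≤⟨ +-mono-≤ (large p) (large p) ⟩
        8 * (y * y + 4 * (m * m) + 1) + 8 * (y * y + 4 * (m * m) + 1) ∎)
        (<⇒≱ (≤-by (163 + 20 * (y * y) + 72 * y + 80 * (m * m) + 288 * m) (excess y m)))
      where
      y = x * x + s
      squares : ∀ y m → 36 * ((y + 1) * (y + 1)) + 144 * ((m + 1) * (m + 1)) ≡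
        6 * (y + 1) * (6 * (y + 1)) + 12 * (m + 1) * (12 * (m + 1))
      squares = solve-∀
      excess : ∀ y m → suc (8 * (y * y + 4 * (m * m) + 1) + 8 * (y * y + 4 * (m * m) + 1)) +
        (163 + 20 * (y * y) + 72 * y + 80 * (m * m) + 288 * m) ≡
        36 * ((y + 1) * (y + 1)) + 144 * ((m + 1) * (m + 1))
      excess = solve-∀

    -- By `gap`, a step of 3 or more would force `4 · 3 · (2 m + 3) < q`, but the left side is at
    -- least `12 (m + 1)`, hence at least `q`.
    steep-gap : ∀ {x m m′} d → Shell Q κ s (x , m) → Steep (x , m) → Shell Q κ s (x , m′) →
      m + d ≤ m′ → d ≤ 2
    steep-gap {m = m} d p steep p′ m+d≤m′ with d ≤? 2
    ... | yes d≤2 = d≤2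
    ... | no  d≰2 = contradiction (begin
        12 * (m + 1)              ≤⟨ ≤-by (12 * m + 24) (lem m) ⟩
        4 * (3 * (2 * m + 3))     ≤⟨ *-monoʳ-≤ 4 (*-mono-≤ 3≤d (+-monoʳ-≤ (2 * m) 3≤d)) ⟩
        4 * (d * (2 * m + d))     ∎) (<⇒≱ (<-≤-trans (gap d p p′ m+d≤m′) steep))
      where
      3≤d = ≰⇒> d≰2
      lem : ∀ m → 12 * (m + 1) + (12 * m + 24) ≡ 4 * (3 * (2 * m + 3))
      lem = solve-∀

    steep-count : AtMost (suc (2 * Q) * 3) (λ p → Shell Q κ s p × Steep p)
    steep-count = atMost-fibres _≟_ proj₁ (λ (p , _) → s≤s (x≤2Q p)) (atMost-< (suc (2 * Q)))
      λ x → atMost-diameter proj₂ 2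
        (λ { (_ , refl) (_ , refl) refl → refl })
        (λ { d ((p , steep) , refl) ((p′ , _) , refl) → steep-gap d p steep p′ })

    gap² : ∀ {x m m′} d → Shell Q κ s (x , m) → Shell Q κ s (x , m′) → m + d ≤ m′ → 4 * (d * d) ≤ q
    gap² {m = m} d p p′ m+d≤m′ =
      ≤-trans (*-monoʳ-≤ 4 (*-monoʳ-≤ d (m≤n+m d (2 * m)))) (<⇒≤ (gap d p p′ m+d≤m′))

    -- q i r is at most 6 (yᵣ² − y²), which the two shell inequalities bound by 24 m² + 6 q.
    flat-gap : ∀ .{{_ : NonZero Q}} {x m m′ mᵣ} i d → Shell Q κ s (x , m) → Flat (x , m) →
      Shell Q κ s (x , m′) → Shell Q κ s (x + i , mᵣ) → m + d ≤ m′ →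
      d * d * (i * (x + i)) ≤ 2 * Q * (2 * Q)
    flat-gap {x} {m} {m′} {mᵣ} i d p flat p′ pᵣ m+d≤m′ = *-cancelʳ-≤ _ _ (4 * q) {{nonzero}} (begin
      d * d * (i * r) * (4 * q)
        ≡⟨ regroup₁ (d * d) (i * r) q ⟩
      4 * (d * d * (i * r * q))
        ≤⟨ *-monoʳ-≤ 4 (*-monoʳ-≤ (d * d) (begin
             i * r * q                    ≤⟨ *-monoʳ-≤ (i * r) flat ⟩
             i * r * (6 * (y + 1))        ≡⟨ regroup₂ (i * r) (y + 1) ⟩
             6 * (i * r * (y + 1))        ≤⟨ *-monoʳ-≤ 6 (climb i mᵣ pᵣ) ⟩
             6 * (4 * (m * m) + q)        ∎)) ⟩
      4 * (d * d * (6 * (4 * (m * m) + q)))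
        ≡⟨ regroup₃ d m q ⟩
      6 * (4 * (d * m) * (4 * (d * m)) + 4 * (d * d) * q)
        -- Both `4 d m` and `4 d²` are at most `q`, since `gap` bounds `8 d m + 4 d²`.
        ≤⟨ *-monoʳ-≤ 6 (+-mono-≤ (*-mono-≤ chord chord) (*-monoˡ-≤ q (gap² d p p′ m+d≤m′))) ⟩
      6 * (q * q + q * q)
        ≤⟨ ≤-by (4 * (q * q)) (regroup₄ Q) ⟩
      2 * Q * (2 * Q) * (4 * q) ∎)
      where
      r = x + i
      y = x * x + s
      nonzero : NonZero (4 * q)
      nonzero = m*n≢0 4 q {{_}} {{m*n≢0 Q Q}}
      regroup₁ : ∀ a b q → a * b * (4 * q) ≡ 4 * (a * (b * q))
      regroup₁ = solve-∀
      regroup₂ : ∀ a b → a * (6 * b) ≡ 6 * (a * b)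
      regroup₂ = solve-∀
      regroup₃ : ∀ d n q → 4 * (d * d * (6 * (4 * (n * n) + q))) ≡
        6 * (4 * (d * n) * (4 * (d * n)) + 4 * (d * d) * q)
      regroup₃ = solve-∀
      regroup₄ : ∀ Q → 6 * (Q * Q * (Q * Q) + Q * Q * (Q * Q)) + 4 * (Q * Q * (Q * Q)) ≡
        2 * Q * (2 * Q) * (4 * (Q * Q))
      regroup₄ = solve-∀
      chord : 4 * (d * m) ≤ q
      chord = ≤-trans (*-monoʳ-≤ 4 (*-monoʳ-≤ d (≤-by (m + d) (lem m d)))) (<⇒≤ (gap d p p′ m+d≤m′))
        where
        lem : ∀ m d → m + (m + d) ≡ 2 * m + d
        lem = solve-∀
      -- With `e = i (x + i)`, passing from `x` to `x + i` raises `y` by at least `e`, hence `y²` by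
      -- at least `2 e y + e²`, which is at least `e (y + 1)`. The case `i = 0` is split off because
      -- `ascent` expresses the surplus `e² - e` through `i = j + 1`, free of subtraction.
      climb : ∀ i mᵣ → Shell Q κ s (x + i , mᵣ) → i * (x + i) * (y + 1) ≤ 4 * (m * m) + q
      climb zero     _  _  = z≤n
      climb i@(suc j) mᵣ pᵣ = +-cancelˡ-≤ (y * y) _ _ (begin
        y * y + i * (x + i) * (y + 1)
          ≤⟨ ≤-by _ (ascent x j s) ⟩
        ((x + i) * (x + i) + s) * ((x + i) * (x + i) + s)
          ≤⟨ m≤m+n _ _ ⟩
        quartic s (x + i , mᵣ)
          ≤⟨ <⇒≤ (upper pᵣ) ⟩
        κ * q + q
          ≤⟨ +-monoˡ-≤ q (lower p) ⟩
        y * y + 4 * (m * m) + q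
          ≡⟨ +-assoc (y * y) _ q ⟩
        y * y + (4 * (m * m) + q) ∎)
        where
        ascent : ∀ x j s →
          let y = x * x + s
              i = suc j
              e = i * (x + i)
          in y * y + e * (y + 1) +
             (i * x * (2 * y) + e * y + e * (x + x * j + 2 * j + j * j) + 2 * (e * (i * x)) + i * x * (i * x)) ≡
             ((x + i) * (x + i) + s) * ((x + i) * (x + i) + s)
        ascent = solve-∀

    -- Row `i` holds the points with `x = r - i`, where `r` is the largest `x` in the list. The at
    -- most `2 Q + 1` rows contribute 1 each; the excesses over 1 are at most `Q` in row 0 and, by
    -- `flat-gap` and `Σ₁-√-bound` with `P = 2 Q`, add up to at most `4 Q` in the other rows.
    flat-count : .{{_ : NonZero Q}} → AtMost (7 * Q + 1) (λ p → Shell Q κ s p × Flat p)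
    flat-count []           _ _   = z≤n
    flat-count xs@(p₀ ∷ xs′) u pxs@(p ∷ ps) = begin
      length xs                          ≡⟨ length-fibres depth r xs (All.tabulate λ {z} _ → m∸n≤m r (proj₁ z)) ⟩
      size 0 + Σ₁ r size                 ≤⟨ +-mono-≤ (m≤suc[m∸1] (size 0)) (Σ₁-mono r λ i → m≤suc[m∸1] (size i)) ⟩
      suc (excess 0) + Σ₁ r (λ i → suc (excess i))
        ≡⟨ cong (suc (excess 0) +_) (Σ₁-suc r excess) ⟩
      suc (excess 0) + (r + Σ₁ r excess)
        ≤⟨ +-mono-≤ (s≤s top-row) (+-mono-≤ (x≤2Q (proj₁ top-flat))
             (Σ₁-√-bound excess (2 * Q) r λ i _ _ → other-rows i)) ⟩
      suc Q + (2 * Q + 2 * (2 * Q))      ≡⟨ lem Q ⟩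
      7 * Q + 1                          ∎
      where
      lem : ∀ Q → suc Q + (2 * Q + 2 * (2 * Q)) ≡ 7 * Q + 1
      lem = solve-∀
      m≤suc[m∸1] : ∀ m → m ≤ suc (m ∸ 1)
      m≤suc[m∸1] m = m≤n+m∸n m 1
      top = argmax proj₁ p₀ xs′
      r = proj₁ top
      top-flat : Shell Q κ s top × Flat top
      top-flat = argmax-all proj₁ p ps
      depth : ℕ × ℕ → ℕ
      depth z = r ∸ proj₁ z
      size excess : ℕ → ℕ
      size i = length (filter (λ z → depth z ≟ i) xs)
      -- This is the gap that `spread` yields in a nonempty row. An empty row has excess 0 by
      -- truncation, which is why `row` asks for `B i 0`.
      excess i = size i ∸ 1
      Row : ℕ → ℕ × ℕ → Set
      Row i z = (Shell Q κ s z × Flat z) × proj₁ z + i ≡ r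
      inRow : ∀ i → All (Row i) (filter (λ z → depth z ≟ i) xs)
      inRow i = All.zipWith (λ { ((pf , z≤r) , refl) → pf , m+[n∸m]≡n z≤r })
        (All.filter⁺ (λ z → depth z ≟ i)
          (All.zip (pxs , f[⊥]≤f[argmax] {f = proj₁} p₀ xs′ ∷ f[xs]≤f[argmax] {f = proj₁} p₀ xs′))
        , All.all-filter (λ z → depth z ≟ i) xs)
      row : (B : ℕ → ℕ → Set) → (∀ i → B i 0) →
        (∀ i {x m m′} d → x + i ≡ r → Shell Q κ s (x , m) → Flat (x , m) → Shell Q κ s (x , m′) →
          m + d ≤ m′ → B i d) → ∀ i → B i (excess i)
      row B B0 h i with filter (λ z → depth z ≟ i) xs in eq | Unique.filter⁺ (λ z → depth z ≟ i) u | inRow i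
      ... | []     | _  | _ = B0 i
      ... | z ∷ zs | u′ | rows =
        let (x , m) , (x′ , m′) , ((px , flat) , x+i≡r) , ((px′ , _) , x′+i≡r) , m+d≤m′ =
              spread proj₂ (λ { {x , m} {x′ , m′} (_ , e) (_ , e′) refl →
                cong (_, m) (+-cancelʳ-≡ i x x′ (trans e (sym e′))) }) (z ∷ zs) u′ rows (s≤s z≤n)
        in h i (length zs) x+i≡r px flat
             (subst (λ a → Shell Q κ s (a , m′)) (+-cancelʳ-≡ i x′ x (trans x′+i≡r (sym x+i≡r))) px′) m+d≤m′
      top-row : excess 0 ≤ Q
      top-row = square-cancel-≤ (row (λ _ d → d * d ≤ q) (λ _ → z≤n)
        (λ _ d _ px _ px′ m+d≤m′ → ≤-trans (m≤n*m (d * d) 4) (gap² d px px′ m+d≤m′)) 0)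
      other-rows : ∀ i → excess i * excess i * (i * r) ≤ 2 * Q * (2 * Q)
      other-rows = row (λ i d → d * d * (i * r) ≤ 2 * Q * (2 * Q)) (λ _ → z≤n)
        λ i d x+i≡r px flat px′ m+d≤m′ → subst (λ a → d * d * (i * a) ≤ 2 * Q * (2 * Q)) x+i≡r
          (flat-gap i d px flat px′
            (subst (λ a → Shell Q κ s (a , proj₂ top)) (sym x+i≡r) (proj₁ top-flat)) m+d≤m′)

    planar-count : .{{_ : NonZero Q}} → AtMost (17 * Q) (Shell Q κ s)
    planar-count = atMost-≤ (begin
      suc (2 * Q) * 3 + (7 * Q + 1)     ≡⟨ lem₁ Q ⟩
      13 * Q + 4 * 1                    ≤⟨ +-monoʳ-≤ (13 * Q) (*-monoʳ-≤ 4 (>-nonZero⁻¹ Q)) ⟩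
      13 * Q + 4 * Q                    ≡⟨ lem₂ Q ⟩
      17 * Q                            ∎)
      (atMost-split (λ (x , m) → q ≤? 12 * (m + 1)) steep-count
        (atMost-⊆ (λ (p , ¬steep) → p , ¬Steep⇒Flat p ¬steep) flat-count))
      where
      lem₁ : ∀ Q → suc (2 * Q) * 3 + (7 * Q + 1) ≡ 13 * Q + 4 * 1
      lem₁ = solve-∀
      lem₂ : ∀ Q → 13 * Q + 4 * Q ≡ 17 * Q
      lem₂ = solve-∀

-- Lattice points in a thin Korányi shell.

module LatticeCount where

  open import Data.Fin.Base using (Fin; zero; suc)
  open import Data.Integer.Base as ℤ using (ℤ; +_; ∣_∣)
  import Data.Integer.Properties as ℤ
  open import Algebra.Properties.AbelianGroup ℤ.+-0-abelianGroup using () renaming (∙-cancelʳ to +ℤ-cancelʳ)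
  open import Data.Nat.Base
  open import Data.Nat.DivMod using (m≡m%n+[m/n]*n; m%n<n)
  open import Data.Nat.Properties
  open import Data.Nat.Tactic.RingSolver using (solve-∀)
  open import Data.Product.Base using (_×_; _,_; proj₁; proj₂)
  open import Data.Product.Properties using (≡-dec)
  open import Data.Sign.Base using (Sign)
  import Data.Sign.Properties as Sign
  open import Data.Unit.Base using (⊤; tt)
  open import Data.Vec.Base using (Vec; []; _∷_; lookup; head; tail; zipWith)
  import Data.Vec.Properties as Vec
  open import Relation.Binary.PropositionalEquality
  open import Relation.Nullary using (yes; no; contradiction)
  open import Defs using (LatticePoint; ⟨_,_⟩)
  open Counting
  open Planar
  open ≤-Reasoning

  atMost-Sign : AtMost 2 (λ (_ : Sign) → ⊤)
  atMost-Sign = atMost-split (Sign._≟ Sign.+) (atMost-⊆ proj₂ (atMost-≡ Sign.+))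
    (atMost-⊆ (λ { {Sign.-} _ → refl ; {Sign.+} (_ , neq) → contradiction refl neq }) (atMost-≡ Sign.-))

  sign-∣∣-injective : ∀ {i j} → ℤ.sign i ≡ ℤ.sign j → ∣ i ∣ ≡ ∣ j ∣ → i ≡ j
  sign-∣∣-injective {i} {j} s a =
    trans (sym (ℤ.◃-inverse i)) (trans (cong₂ ℤ._◃_ s a) (ℤ.◃-inverse j))

  atMost-∣∣≤ : ∀ B → AtMost (2 * suc B) (λ i → ∣ i ∣ ≤ B)
  atMost-∣∣≤ B = atMost-injective {R = λ (_ , n) → ⊤ × n < suc B} (λ i → ℤ.sign i , ∣ i ∣)
    (λ _ _ eq → sign-∣∣-injective (cong proj₁ eq) (cong proj₂ eq))
    (λ i≤B → tt , s≤s i≤B) (atMost-× Sign._≟_ atMost-Sign (atMost-< (suc B)))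

  Box : ∀ {m} → ℕ → Vec ℤ m → Set
  Box B v = ∀ i → ∣ lookup v i ∣ ≤ B

  atMost-Box : ∀ m B → AtMost ((2 * suc B) ^ m) (Box {m} B)
  atMost-Box zero    B = atMost-⊆ (λ { {[]} _ → refl }) (atMost-≡ [])
  atMost-Box (suc m) B = atMost-injective (λ v → head v , tail v)
    (λ { {_ ∷ _} {_ ∷ _} _ _ refl → refl }) (λ { {_ ∷ _} h → h zero , λ i → h (suc i) })
    (atMost-× ℤ._≟_ (atMost-∣∣≤ B) (atMost-Box m B))

  ^-distribʳ-* : ∀ k a b → (a * b) ^ k ≡ a ^ k * b ^ k
  ^-distribʳ-* zero    a b = refl
  ^-distribʳ-* (suc k) a b = trans (cong (a * b *_) (^-distribʳ-* k a b)) (lem a b (a ^ k) (b ^ k))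
    where
    lem : ∀ a b c d → a * b * (c * d) ≡ a * c * (b * d)
    lem = solve-∀

  normSq : ∀ {m} → Vec ℤ m → ℕ
  normSq []     = 0
  normSq (a ∷ as) = ∣ a ∣ * ∣ a ∣ + normSq as

  lookup²≤normSq : ∀ {m} (v : Vec ℤ m) i → ∣ lookup v i ∣ * ∣ lookup v i ∣ ≤ normSq v
  lookup²≤normSq (a ∷ as) zero    = m≤m+n _ _
  lookup²≤normSq (a ∷ as) (suc i) = m≤n⇒m≤o+n _ (lookup²≤normSq as i)

  -- The fourth power of the Korányi norm of the point (a , z / 2).
  korányi⁴ : ∀ {m} → Vec ℤ m × ℤ → ℕ
  korányi⁴ (a , z) = normSq a * normSq a + 4 * (∣ z ∣ * ∣ z ∣)

  -- Integral consequences of the fourth root of `N` being within `t` of `Q`, where `t ≤ 1` and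
  -- `Q t ≤ T`. `above` and `below` leave a number of layers proportional to `T`; `large` and
  -- `small` come from `t ≤ 1`.
  record ThinShell (Q T N : ℕ) : Set where
    field
      above : Q * Q * (Q * Q) ≤ N + 4 * T * (Q * Q)
      below : N ≤ Q * Q * (Q * Q) + 15 * T * (Q * Q)
      large : Q * Q * (Q * Q) ≤ 8 * (N + 1)
      small : N ≤ 16 * (Q * Q * (Q * Q))

  module _ {Q T : ℕ} .{{_ : NonZero Q}} .{{_ : NonZero T}} where

    private
      q = Q * Q
      instance
        q≢0 : NonZero q
        q≢0 = m*n≢0 Q Q

    Layer : ℕ → Set
    Layer κ = q ≤ κ + 4 * T × κ ≤ q + 15 * T

    layer : ∀ {N} → ThinShell Q T N → Layer (N / q)
    layer {N} t = s≤s⁻¹ (*-cancelʳ-< q _ _ (begin-strict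
        q * q                           ≤⟨ above ⟩
        N + 4 * T * q                   <⟨ +-monoˡ-< _ (N<) ⟩
        κ * q + q + 4 * T * q           ≡⟨ lem₁ κ q T ⟩
        suc (κ + 4 * T) * q             ∎))
      , *-cancelʳ-≤ _ _ q (begin
        κ * q                           ≤⟨ ≤N ⟩
        N                               ≤⟨ below ⟩
        q * q + 15 * T * q              ≡⟨ *-distribʳ-+ q q (15 * T) ⟨
        (q + 15 * T) * q                ∎)
      where
      open ThinShell t
      κ = N / q
      lem₁ : ∀ κ q T → κ * q + q + 4 * T * q ≡ suc (κ + 4 * T) * q
      lem₁ = solve-∀
      ≤N : κ * q ≤ N
      ≤N = subst (κ * q ≤_) (sym (m≡m%n+[m/n]*n N q)) (m≤n+m _ _)
      N< : N < κ * q + q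
      N< = subst (_< κ * q + q) (sym (trans (m≡m%n+[m/n]*n N q) (+-comm (N % q) _)))
        (+-monoʳ-< (κ * q) (m%n<n N q))

    -- Shifting `κ` by `4 T` makes the interval start at `q`; its natural start `q - 4 T` may be
    -- negative.
    atMost-Layer : AtMost (19 * T + 1) Layer
    atMost-Layer = atMost-injective (_+ 4 * T) (λ _ _ → +-cancelʳ-≡ (4 * T) _ _)
      (λ {κ} (l , u) → l , (begin-strict
        κ + 4 * T              ≤⟨ +-monoˡ-≤ (4 * T) u ⟩
        q + 15 * T + 4 * T     <⟨ ≤-reflexive (lem q T) ⟩
        q + (19 * T + 1)       ∎))
      (atMost-interval q (19 * T + 1))
      where
      lem : ∀ q T → suc (q + 15 * T + 4 * T) ≡ q + (19 * T + 1)
      lem = solve-∀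

    planar-shell : ∀ {x s z N} → N ≡ quartic s (x , z) → ThinShell Q T N → Shell Q (N / q) s (x , z)
    planar-shell {N = N} refl t = record
      { lower = subst (N / q * q ≤_) (sym (m≡m%n+[m/n]*n N q)) (m≤n+m _ _)
      ; upper = subst (_< N / q * q + q) (sym (trans (m≡m%n+[m/n]*n N q) (+-comm (N % q) _)))
          (+-monoʳ-< (N / q * q) (m%n<n N q))
      ; large = ThinShell.large t
      ; small = ThinShell.small t
      }

    ThinShell-Box : ∀ {m} (a : Vec ℤ m) z → ThinShell Q T (korányi⁴ (a , z)) → Box (2 * Q) a
    ThinShell-Box a z t i = square-cancel-≤ (square-cancel-≤ (begin
      α * α * (α * α)                            ≤⟨ *-mono-≤ (lookup²≤normSq a i) (lookup²≤normSq a i) ⟩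
      normSq a * normSq a                            ≤⟨ m≤m+n _ _ ⟩
      korányi⁴ (a , z)                           ≤⟨ ThinShell.small t ⟩
      16 * (q * q)                               ≡⟨ lem Q ⟩
      2 * Q * (2 * Q) * (2 * Q * (2 * Q))        ∎))
      where
      α = ∣ lookup a i ∣
      lem : ∀ Q → 16 * (Q * Q * (Q * Q)) ≡ 2 * Q * (2 * Q) * (2 * Q * (2 * Q))
      lem = solve-∀

    -- The constant `1360` is `20 · 4 · 17`, from at most `20 T` layers, four pairs of signs and
    -- `17 Q` points of a planar shell. Each of the `m` fixed coordinates is at most `2 Q` in
    -- absolute value and costs a factor `6 Q`; their squared norm is the planar parameter `s`.
    shell-count : ∀ m → AtMost (1360 * 6 ^ m * (Q ^ suc m * T))
      (λ (p : Vec ℤ (suc m) × ℤ) → ThinShell Q T (korányi⁴ p))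
    shell-count m = atMost-≤ (begin
        (2 * suc (2 * Q)) ^ m * ((19 * T + 1) * (2 * 2)) * (17 * Q)
          ≤⟨ *-monoˡ-≤ (17 * Q) (*-mono-≤ (^-monoˡ-≤ m 2[2Q+1]≤6Q) (*-monoˡ-≤ (2 * 2) 19T+1≤20T)) ⟩
        (6 * Q) ^ m * (20 * T * (2 * 2)) * (17 * Q)
          ≡⟨ cong (λ a → a * (20 * T * (2 * 2)) * (17 * Q)) (^-distribʳ-* m 6 Q) ⟩
        6 ^ m * Q ^ m * (20 * T * (2 * 2)) * (17 * Q)
          ≡⟨ collect (6 ^ m) (Q ^ m) Q T ⟩
        1360 * 6 ^ m * (Q ^ suc m * T) ∎)
      (atMost-fibres
        (≡-dec (Vec.≡-dec ℤ._≟_) (≡-dec _≟_ (≡-dec Sign._≟_ Sign._≟_)))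
        (λ p@(a , z) → tail a , korányi⁴ p / q , ℤ.sign (head a) , ℤ.sign z)
        (λ { {a₀ ∷ a , z} t → (λ i → ThinShell-Box (a₀ ∷ a) z t (suc i)) , layer t , tt , tt })
        (atMost-× (Vec.≡-dec ℤ._≟_) (atMost-Box m (2 * Q))
          (atMost-× _≟_ atMost-Layer (atMost-× Sign._≟_ atMost-Sign atMost-Sign)))
        λ (a , κ , _) → atMost-injective {R = Shell Q κ (normSq a)} (λ (a , z) → ∣ head a ∣ , ∣ z ∣)
          (λ { {a₀ ∷ _ , _} {b₀ ∷ _ , _} (_ , e) (_ , e′) eq → fibre-injective (trans e (sym e′)) eq })
          (λ { {a₀ ∷ a , z} (t , refl) → planar-shell {∣ a₀ ∣} {normSq a} {∣ z ∣} refl t })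
          planar-count)
      where
      fibre-injective : ∀ {a₀ b₀ z w : ℤ} {a b : Vec ℤ m} {k l : ℕ} →
        (a , k , ℤ.sign a₀ , ℤ.sign z) ≡ (b , l , ℤ.sign b₀ , ℤ.sign w) →
        (∣ a₀ ∣ , ∣ z ∣) ≡ (∣ b₀ ∣ , ∣ w ∣) → (a₀ ∷ a , z) ≡ (b₀ ∷ b , w)
      fibre-injective e eq = cong₂ _,_
        (cong₂ _∷_ (sign-∣∣-injective (cong (λ k → proj₁ (proj₂ (proj₂ k))) e) (cong proj₁ eq)) (cong proj₁ e))
        (sign-∣∣-injective (cong (λ k → proj₂ (proj₂ (proj₂ k))) e) (cong proj₂ eq))
      lem₁ : ∀ Q → 2 * suc (2 * Q) ≡ 4 * Q + 2 * 1
      lem₁ = solve-∀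
      lem₂ : ∀ Q → 4 * Q + 2 * Q ≡ 6 * Q
      lem₂ = solve-∀
      lem₃ : ∀ T → 19 * T + T ≡ 20 * T
      lem₃ = solve-∀
      2[2Q+1]≤6Q : 2 * suc (2 * Q) ≤ 6 * Q
      2[2Q+1]≤6Q = begin
        2 * suc (2 * Q)   ≡⟨ lem₁ Q ⟩
        4 * Q + 2 * 1     ≤⟨ +-monoʳ-≤ (4 * Q) (*-monoʳ-≤ 2 (>-nonZero⁻¹ Q)) ⟩
        4 * Q + 2 * Q     ≡⟨ lem₂ Q ⟩
        6 * Q             ∎
      19T+1≤20T : 19 * T + 1 ≤ 20 * T
      19T+1≤20T = ≤-trans (+-monoʳ-≤ (19 * T) (>-nonZero⁻¹ T)) (≤-reflexive (lem₃ T))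
      collect : ∀ s r Q T → s * r * (20 * T * (2 * 2)) * (17 * Q) ≡ 1360 * s * (Q * r * T)
      collect = solve-∀

  module _ {n : ℕ} (σ : Vec ℤ (n + n) → Vec ℤ (n + n) → ℤ) where

    -- Horizontal part and doubled vertical part of u ∗ v ⁻¹, when σ is the symplectic form of u and v ⁻¹.
    difference : LatticePoint n → LatticePoint n → Vec ℤ (n + n) × ℤ
    difference ⟨ b , y ⟩ ⟨ c , z ⟩ = zipWith ℤ._-_ b c , + 2 ℤ.* (y ℤ.- z) ℤ.+ σ b c

    -- The horizontal part recovers `b`; then `σ b c` is the same on both sides and cancels from the
    -- vertical part.
    difference-injective : ∀ {u u′} v → difference u v ≡ difference u′ v → u ≡ u′
    difference-injective {⟨ b , y ⟩} {⟨ b′ , y′ ⟩} ⟨ c , z ⟩ eq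
      with zipWith-cancel b b′ c (cong proj₁ eq)
      where
      zipWith-cancel : ∀ {m} (b b′ c : Vec ℤ m) → zipWith ℤ._-_ b c ≡ zipWith ℤ._-_ b′ c → b ≡ b′
      zipWith-cancel []      []        []      _ = refl
      zipWith-cancel (x ∷ b) (x′ ∷ b′) (c ∷ cs) eq = cong₂ _∷_
        (+ℤ-cancelʳ (ℤ.- c) x x′ (cong head eq)) (zipWith-cancel b b′ cs (cong tail eq))
    ... | refl = cong ⟨ b ,_⟩ (+ℤ-cancelʳ (ℤ.- z) y y′ (ℤ.*-cancelˡ-≡ (+ 2) _ _
      (+ℤ-cancelʳ (σ b c) _ _ (cong proj₂ eq))))

    BoxPoint : ℕ → ℕ → LatticePoint n → Set
    BoxPoint C Q ⟨ b , z ⟩ = Box (C * Q) b × ∣ z ∣ ≤ C * Q ^ 2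

    -- As `Q ≥ 1`, the 1 in `C Q + 1` is absorbed into `(C + 1) Q`, and likewise for `Q²`. This
    -- leaves the pure power `Q ^ (2 n + 2)` that the normalising factor of the theorem cancels.
    atMost-BoxPoint : ∀ C Q .{{_ : NonZero Q}} → let c = 2 * suc C in
      AtMost (c ^ suc (n + n) * Q ^ (n + n + 2)) (BoxPoint C Q)
    atMost-BoxPoint C Q = atMost-≤ (begin
        (2 * suc (C * Q)) ^ (n + n) * (2 * suc (C * Q ^ 2))
          ≤⟨ *-mono-≤ (^-monoˡ-≤ (n + n) (round Q)) (round (Q ^ 2) {{m^n≢0 Q 2}}) ⟩
        (c * Q) ^ (n + n) * (c * Q ^ 2)
          ≡⟨ cong (_* (c * Q ^ 2)) (^-distribʳ-* (n + n) c Q) ⟩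
        c ^ (n + n) * Q ^ (n + n) * (c * Q ^ 2)
          ≡⟨ regroup (c ^ (n + n)) (Q ^ (n + n)) c (Q ^ 2) ⟩
        c * c ^ (n + n) * (Q ^ (n + n) * Q ^ 2)
          ≡⟨ cong (c * c ^ (n + n) *_) (^-distribˡ-+-* Q (n + n) 2) ⟨
        c ^ suc (n + n) * Q ^ (n + n + 2) ∎)
      (atMost-injective (λ { ⟨ b , z ⟩ → b , z }) (λ { _ _ refl → refl }) (λ p → p)
        (atMost-× (Vec.≡-dec ℤ._≟_) (atMost-Box (n + n) (C * Q)) (atMost-∣∣≤ (C * Q ^ 2))))
      where
      c = 2 * suc C
      round : ∀ R .{{_ : NonZero R}} → 2 * suc (C * R) ≤ c * R
      round R = ≤-trans (*-monoʳ-≤ 2 (+-monoˡ-≤ (C * R) (>-nonZero⁻¹ R)))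
        (≤-reflexive (sym (*-assoc 2 (suc C) R)))
      regroup : ∀ a b c d → a * b * (c * d) ≡ c * a * (b * d)
      regroup = solve-∀

  pair-constant : ℕ → ℕ → ℕ
  pair-constant C n = (2 * suc C) ^ suc (n + n) * (1360 * 6 ^ pred (n + n))

  pair-count : ∀ n .{{_ : NonZero n}} (σ : Vec ℤ (n + n) → Vec ℤ (n + n) → ℤ) C Q T →
    .{{_ : NonZero Q}} .{{_ : NonZero T}} →
    AtMost (pair-constant C n * (Q ^ (n + n + 2) * (Q ^ (n + n) * T)))
      (λ ((u , v) : LatticePoint n × LatticePoint n) →
        BoxPoint σ C Q v × ThinShell Q T (korányi⁴ (difference σ u v)))
  pair-count n@(suc k) σ C Q T = atMost-≤ (≤-reflexive
      (regroup ((2 * suc C) ^ suc (n + n)) (Q ^ (n + n + 2)) (1360 * 6 ^ pred (n + n)) (Q ^ (n + n) * T)))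
    (atMost-fibres _≟ᴸ_ proj₂ proj₁ (atMost-BoxPoint σ C Q) λ v →
      atMost-injective (λ (u , v) → difference σ u v)
        (λ { (_ , refl) (_ , refl) eq → cong (_, v) (difference-injective σ v eq) })
        -- Here `n ≥ 1` enters: `n + n` is `suc (k + suc k)`, so there is a first coordinate to
        -- split off.
        (λ ((_ , t) , _) → t) (shell-count (k + suc k)))
    where
    regroup : ∀ a b c d → a * b * (c * d) ≡ a * c * (b * d)
    regroup = solve-∀
    _≟ᴸ_ : (u v : LatticePoint n) → _
    ⟨ b , y ⟩ ≟ᴸ ⟨ c , z ⟩ with ≡-dec (Vec.≡-dec ℤ._≟_) ℤ._≟_ (b , y) (c , z)
    ... | yes refl = yes refl
    ... | no  neq  = no λ { refl → neq refl }

-- Rational estimates for fourth powers near `Q⁴`.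

module RationalShell where

  open import Data.Integer.Base as ℤ using (ℤ; +_)
  import Data.Integer.Properties as ℤ
  import Data.Integer.Solver as ℤ-Solver
  open import Data.Nat.Base as ℕ using (ℕ; zero; suc; NonZero)
  import Data.Nat.Properties as ℕ
  open import Data.Product.Base using (∃-syntax; _×_; _,_)
  open import Data.Rational.Base hiding (NonZero)
  open import Data.Rational.Properties
  open import Data.Rational.Solver using (module +-*-Solver)
  import Data.Rational.Unnormalised.Base as ℚᵘ
  import Data.Rational.Unnormalised.Properties as ℚᵘ
  open import Data.Sum.Base using (inj₁; inj₂)
  open import Relation.Binary.PropositionalEquality
  open import Defs using (module RationalLemmas)
  open RationalLemmas using (+-nonNeg; *-nonNeg; *-mono; *-monoˡ; p≤p+q; _⁴; ⁴-mono; q<grid; limit; +-cancelʳ-≤)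
  open LatticeCount using (ThinShell)
  open +-*-Solver using (solve; _:=_; _:+_; _:*_; :-_; _:-_; con)

  fromInt : ℤ → ℚ
  fromInt z = z / 1

  fromNat : ℕ → ℚ
  fromNat n = fromInt (+ n)

  toℚᵘ-fromInt : ∀ z → toℚᵘ (fromInt z) ℚᵘ.≃ ℚᵘ.mkℚᵘ z 0
  toℚᵘ-fromInt z = toℚᵘ-fromℚᵘ (ℚᵘ.mkℚᵘ z 0)

  fromInt-+ : ∀ a b → fromInt (a ℤ.+ b) ≡ fromInt a + fromInt b
  fromInt-+ a b = toℚᵘ-injective (begin
    toℚᵘ (fromInt (a ℤ.+ b))                   ≈⟨ toℚᵘ-fromInt (a ℤ.+ b) ⟩
    ℚᵘ.mkℚᵘ (a ℤ.+ b) 0                        ≈⟨ ℚᵘ.*≡* (lem a b) ⟩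
    ℚᵘ.mkℚᵘ a 0 ℚᵘ.+ ℚᵘ.mkℚᵘ b 0               ≈⟨ ℚᵘ.+-cong (toℚᵘ-fromInt a) (toℚᵘ-fromInt b) ⟨
    toℚᵘ (fromInt a) ℚᵘ.+ toℚᵘ (fromInt b)     ≈⟨ toℚᵘ-homo-+ (fromInt a) (fromInt b) ⟨
    toℚᵘ (fromInt a + fromInt b)               ∎)
    where
    open ℚᵘ.≃-Reasoning
    open ℤ-Solver.+-*-Solver renaming (solve to solveℤ; _:=_ to _:=ℤ_; _:+_ to _:+ℤ_; _:*_ to _:*ℤ_; con to conℤ)
    lem : ∀ a b → (a ℤ.+ b) ℤ.* + 1 ≡ (a ℤ.* + 1 ℤ.+ b ℤ.* + 1) ℤ.* + 1
    lem = solveℤ 2 (λ a b → (a :+ℤ b) :*ℤ conℤ (+ 1) :=ℤ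
      (a :*ℤ conℤ (+ 1) :+ℤ b :*ℤ conℤ (+ 1)) :*ℤ conℤ (+ 1)) refl

  fromInt-* : ∀ a b → fromInt (a ℤ.* b) ≡ fromInt a * fromInt b
  fromInt-* a b = toℚᵘ-injective (begin
    toℚᵘ (fromInt (a ℤ.* b))                   ≈⟨ toℚᵘ-fromInt (a ℤ.* b) ⟩
    ℚᵘ.mkℚᵘ a 0 ℚᵘ.* ℚᵘ.mkℚᵘ b 0               ≈⟨ ℚᵘ.*-cong (toℚᵘ-fromInt a) (toℚᵘ-fromInt b) ⟨
    toℚᵘ (fromInt a) ℚᵘ.* toℚᵘ (fromInt b)     ≈⟨ toℚᵘ-homo-* (fromInt a) (fromInt b) ⟨
    toℚᵘ (fromInt a * fromInt b)               ∎)
    where open ℚᵘ.≃-Reasoning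

  fromInt-neg : ∀ a → fromInt (ℤ.- a) ≡ - fromInt a
  fromInt-neg a = toℚᵘ-injective (begin
    toℚᵘ (fromInt (ℤ.- a))      ≈⟨ toℚᵘ-fromInt (ℤ.- a) ⟩
    ℚᵘ.- ℚᵘ.mkℚᵘ a 0            ≈⟨ ℚᵘ.-‿cong (toℚᵘ-fromInt a) ⟨
    ℚᵘ.- toℚᵘ (fromInt a)       ≈⟨ toℚᵘ-homo‿- (fromInt a) ⟨
    toℚᵘ (- fromInt a)          ∎)
    where open ℚᵘ.≃-Reasoning

  1/n*n≡1 : ∀ n .{{_ : NonZero n}} → (+ 1 / n) * fromNat n ≡ 1ℚ
  1/n*n≡1 n@(suc k) = toℚᵘ-injective (begin
    toℚᵘ ((+ 1 / n) * fromNat n)            ≈⟨ toℚᵘ-homo-* (+ 1 / n) (fromNat n) ⟩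
    toℚᵘ (+ 1 / n) ℚᵘ.* toℚᵘ (fromNat n)
      ≈⟨ ℚᵘ.*-cong (toℚᵘ-fromℚᵘ (ℚᵘ.mkℚᵘ (+ 1) k)) (toℚᵘ-fromInt (+ n)) ⟩
    ℚᵘ.mkℚᵘ (+ 1) k ℚᵘ.* ℚᵘ.mkℚᵘ (+ n) 0    ≈⟨ ℚᵘ.*≡* (lem (+ n)) ⟩
    ℚᵘ.1ℚᵘ ∎)
    where
    open ℚᵘ.≃-Reasoning
    open ℤ-Solver.+-*-Solver renaming (solve to solveℤ; _:=_ to _:=ℤ_; _:*_ to _:*ℤ_; con to conℤ)
    lem : ∀ n → (+ 1 ℤ.* n) ℤ.* + 1 ≡ + 1 ℤ.* (n ℤ.* + 1)
    lem = solveℤ 1 (λ n → (conℤ (+ 1) :*ℤ n) :*ℤ conℤ (+ 1) :=ℤ conℤ (+ 1) :*ℤ (n :*ℤ conℤ (+ 1))) refl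

  fromNat-+ : ∀ a b → fromNat (a ℕ.+ b) ≡ fromNat a + fromNat b
  fromNat-+ a b = fromInt-+ (+ a) (+ b)

  fromNat-* : ∀ a b → fromNat (a ℕ.* b) ≡ fromNat a * fromNat b
  fromNat-* a b = trans (cong fromInt (ℤ.pos-* a b)) (fromInt-* (+ a) (+ b))

  fromNat-mono : ∀ {a b} → a ℕ.≤ b → fromNat a ≤ fromNat b
  fromNat-mono {a} {b} a≤b = toℚᵘ-cancel-≤
    (ℚᵘ.≤-respʳ-≃ (ℚᵘ.≃-sym (toℚᵘ-fromInt (+ b))) (ℚᵘ.≤-respˡ-≃ (ℚᵘ.≃-sym (toℚᵘ-fromInt (+ a)))
      (ℚᵘ.*≤* (ℤ.*-monoʳ-≤-nonNeg (+ 1) (ℤ.+≤+ a≤b)))))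

  fromNat-cancel-≤ : ∀ {a b} → fromNat a ≤ fromNat b → a ℕ.≤ b
  fromNat-cancel-≤ {a} {b} h with ℚᵘ.≤-respʳ-≃ (toℚᵘ-fromInt (+ b))
    (ℚᵘ.≤-respˡ-≃ (toℚᵘ-fromInt (+ a)) (toℚᵘ-mono-≤ h))
  ... | ℚᵘ.*≤* le = ℤ.drop‿+≤+ (ℤ.*-cancelʳ-≤-pos (+ a) (+ b) (+ 1) le)

  fromNat-nonNeg : ∀ n → 0ℚ ≤ fromNat n
  fromNat-nonNeg n = fromNat-mono {0} {n} ℕ.z≤n

  1≤fromNat : ∀ n .{{_ : NonZero n}} → 1ℚ ≤ fromNat n
  1≤fromNat n = fromNat-mono {1} {n} (ℕ.>-nonZero⁻¹ n)

  ≤-by : ∀ {a b} c → 0ℚ ≤ c → a + c ≡ b → a ≤ b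
  ≤-by {a} c 0≤c eq = subst (a ≤_) eq (p≤p+q 0≤c)

  0≤q-p : ∀ {p q} → p ≤ q → 0ℚ ≤ q - p
  0≤q-p {p} {q} p≤q = +-cancelʳ-≤ p (subst₂ _≤_ (sym (+-identityˡ p))
    (solve 2 (λ p q → q := (q :- p) :+ p) refl p q) p≤q)

  square-nonNeg : ∀ p → 0ℚ ≤ p * p
  square-nonNeg p with ≤-total 0ℚ p
  ... | inj₁ 0≤p = *-nonNeg 0≤p 0≤p
  ... | inj₂ p≤0 = subst (0ℚ ≤_) (solve 1 (λ p → :- p :* :- p := p :* p) refl p)
    (*-nonNeg (neg-antimono-≤ p≤0) (neg-antimono-≤ p≤0))

  open ≤-Reasoning

  module _ {X T t : ℚ} (0≤t : 0ℚ ≤ t) (t≤1 : t ≤ 1ℚ) (1≤X : 1ℚ ≤ X) (Xt≤T : X * t ≤ T) where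

    private
      0≤X = ≤-trans (nonNegative⁻¹ 1ℚ) 1≤X
      t≤X = ≤-trans t≤1 1≤X

    -- Since `t ≤ X`, the sum `4 X³ t + 6 X² t² + 4 X t³ + t⁴` is at most `(4 + 6 + 4 + 1) X³ t`,
    -- and `X t ≤ T`.
    [X+t]⁴≤X⁴+15TX² : (X + t) ⁴ ≤ X * X * (X * X) + fromNat 15 * T * (X * X)
    [X+t]⁴≤X⁴+15TX² = ≤-by
      (fromNat 15 * (T - X * t) * (X * X) +
        t * (X - t) * (fromNat 11 * (X * X) + fromNat 5 * (X * t) + t * t))
      (+-nonNeg (*-nonNeg (*-nonNeg (fromNat-nonNeg 15) (0≤q-p Xt≤T)) (*-nonNeg 0≤X 0≤X))
        (*-nonNeg (*-nonNeg 0≤t (0≤q-p t≤X))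
          (+-nonNeg (+-nonNeg (*-nonNeg (fromNat-nonNeg 11) (*-nonNeg 0≤X 0≤X))
            (*-nonNeg (fromNat-nonNeg 5) (*-nonNeg 0≤X 0≤t))) (*-nonNeg 0≤t 0≤t))))
      (solve 3 (λ X t T →
        (X :+ t) :* (X :+ t) :* ((X :+ t) :* (X :+ t)) :+
        (con (fromNat 15) :* (T :- X :* t) :* (X :* X) :+
          t :* (X :- t) :* (con (fromNat 11) :* (X :* X) :+ con (fromNat 5) :* (X :* t) :+ t :* t)) :=
        X :* X :* (X :* X) :+ con (fromNat 15) :* T :* (X :* X)) refl X t T)

    [X+t]⁴≤16X⁴ : (X + t) ⁴ ≤ fromNat 16 * (X * X * (X * X))
    [X+t]⁴≤16X⁴ = begin
      (X + t) ⁴                        ≤⟨ ⁴-mono (+-nonNeg 0≤X 0≤t) (+-monoʳ-≤ X t≤X) ⟩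
      (X + X) ⁴
        ≡⟨ solve 1 (λ X → (X :+ X) :* (X :+ X) :* ((X :+ X) :* (X :+ X)) :=
             con (fromNat 16) :* (X :* X :* (X :* X))) refl X ⟩
      fromNat 16 * (X * X * (X * X))   ∎

    -- Convexity: `r⁴` is at least the value `X⁴ - 4 X³ (X - r)` of the tangent at `X`, and
    -- `X - r ≤ t`.
    X⁴≤r⁴+4TX² : ∀ {r} → 0ℚ ≤ r → X ≤ r + t → X * X * (X * X) ≤ r ⁴ + fromNat 4 * T * (X * X)
    X⁴≤r⁴+4TX² {r} 0≤r X≤r+t with ≤-total X r
    ... | inj₁ X≤r = ≤-trans (⁴-mono 0≤X X≤r)
      (p≤p+q (*-nonNeg (*-nonNeg (fromNat-nonNeg 4) (≤-trans (*-nonNeg 0≤X 0≤t) Xt≤T)) (*-nonNeg 0≤X 0≤X)))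
    ... | inj₂ r≤X = begin
      X * X * (X * X)
        ≤⟨ ≤-by (a * a * (X * X + X * (X + r) + (X * X + X * r + r * r)))
             (*-nonNeg (square-nonNeg a) (+-nonNeg
               (+-nonNeg (*-nonNeg 0≤X 0≤X) (*-nonNeg 0≤X (+-nonNeg 0≤X 0≤r)))
               (+-nonNeg (+-nonNeg (*-nonNeg 0≤X 0≤X) (*-nonNeg 0≤X 0≤r)) (*-nonNeg 0≤r 0≤r))))
             (solve 2 (λ X r →
               X :* X :* (X :* X) :+
               (X :- r) :* (X :- r) :* (X :* X :+ X :* (X :+ r) :+ (X :* X :+ X :* r :+ r :* r)) :=
               r :* r :* (r :* r) :+ con (fromNat 4) :* (X :* (X :- r)) :* (X :* X)) refl X r) ⟩
      r ⁴ + fromNat 4 * (X * a) * (X * X)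
        ≤⟨ +-monoʳ-≤ (r ⁴) (*-mono (*-nonNeg 0≤X 0≤X)
             (*-nonNeg (fromNat-nonNeg 4) (≤-trans (*-nonNeg 0≤X 0≤t) Xt≤T))
             (*-monoˡ (fromNat-nonNeg 4) (≤-trans (*-monoˡ 0≤X a≤t) Xt≤T)) ≤-refl) ⟩
      r ⁴ + fromNat 4 * T * (X * X) ∎
      where
      a = X - r
      a≤t : a ≤ t
      a≤t = +-cancelʳ-≤ r (subst₂ _≤_ (solve 2 (λ X r → X := (X :- r) :+ r) refl X r) (+-comm r t) X≤r+t)

  -- The power mean inequality for `r` and 1. The two sides touch at `r = 1`, whence the factor
  -- `(r - 1)²` in their difference.
  [r+1]⁴≤8[r⁴+1] : ∀ {r} → 0ℚ ≤ r → (r + 1ℚ) ⁴ ≤ fromNat 8 * (r ⁴ + 1ℚ)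
  [r+1]⁴≤8[r⁴+1] {r} 0≤r = ≤-by
    ((r - 1ℚ) * (r - 1ℚ) * (fromNat 7 * (r * r) + fromNat 10 * r + fromNat 7))
    (*-nonNeg (square-nonNeg (r - 1ℚ)) (+-nonNeg (+-nonNeg
      (*-nonNeg (fromNat-nonNeg 7) (square-nonNeg r)) (*-nonNeg (fromNat-nonNeg 10) 0≤r)) (fromNat-nonNeg 7)))
    (solve 1 (λ r →
      (r :+ con 1ℚ) :* (r :+ con 1ℚ) :* ((r :+ con 1ℚ) :* (r :+ con 1ℚ)) :+
      (r :- con 1ℚ) :* (r :- con 1ℚ) :*
        (con (fromNat 7) :* (r :* r) :+ con (fromNat 10) :* r :+ con (fromNat 7)) :=
      con (fromNat 8) :* (r :* r :* (r :* r) :+ con 1ℚ)) refl r)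

  fromNat-quartic : ∀ Q → fromNat (Q ℕ.* Q ℕ.* (Q ℕ.* Q)) ≡ fromNat Q * fromNat Q * (fromNat Q * fromNat Q)
  fromNat-quartic Q = trans (fromNat-* (Q ℕ.* Q) (Q ℕ.* Q)) (cong₂ _*_ (fromNat-* Q Q) (fromNat-* Q Q))

  fromNat-tube : ∀ k T Q → fromNat (k ℕ.* T ℕ.* (Q ℕ.* Q)) ≡ fromNat k * fromNat T * (fromNat Q * fromNat Q)
  fromNat-tube k T Q = trans (fromNat-* (k ℕ.* T) (Q ℕ.* Q)) (cong₂ _*_ (fromNat-* k T) (fromNat-* Q Q))

  -- `r` and `s` bound the fourth root of `N` from below and above. `s ≤ Q + t` gives `below` and
  -- `small`; `Q ≤ r + t` gives `above` and `large`.
  thinShell : ∀ {Q T N : ℕ} .{{_ : NonZero Q}} {r s t : ℚ} → 0ℚ ≤ t → t ≤ 1ℚ → fromNat Q * t ≤ fromNat T →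
    0ℚ ≤ r → 0ℚ ≤ s → r ⁴ ≤ fromNat N → fromNat N ≤ s ⁴ → s ≤ fromNat Q + t → fromNat Q ≤ r + t →
    ThinShell Q T N
  thinShell {Q} {T} {N} {r} {s} {t} 0≤t t≤1 Qt≤T 0≤r 0≤s r⁴≤N N≤s⁴ s≤Q+t Q≤r+t = record
    { above = fromNat-cancel-≤ (begin
        fromNat (Q ℕ.* Q ℕ.* (Q ℕ.* Q))      ≡⟨ fromNat-quartic Q ⟩
        X * X * (X * X)                      ≤⟨ X⁴≤r⁴+4TX² 0≤t t≤1 1≤X Qt≤T 0≤r Q≤r+t ⟩
        r ⁴ + fromNat 4 * fromNat T * (X * X)
          ≤⟨ +-monoˡ-≤ (fromNat 4 * fromNat T * (X * X)) r⁴≤N ⟩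
        fromNat N + fromNat 4 * fromNat T * (X * X)
          ≡⟨ trans (fromNat-+ N _) (cong (λ p → fromNat N + p) (fromNat-tube 4 T Q)) ⟨
        fromNat (N ℕ.+ 4 ℕ.* T ℕ.* (Q ℕ.* Q)) ∎)
    ; below = fromNat-cancel-≤ (begin
        fromNat N                            ≤⟨ N≤[X+t]⁴ ⟩
        (X + t) ⁴                            ≤⟨ [X+t]⁴≤X⁴+15TX² 0≤t t≤1 1≤X Qt≤T ⟩
        X * X * (X * X) + fromNat 15 * fromNat T * (X * X)
          ≡⟨ trans (fromNat-+ (Q ℕ.* Q ℕ.* (Q ℕ.* Q)) _) (cong₂ _+_ (fromNat-quartic Q) (fromNat-tube 15 T Q)) ⟨
        fromNat (Q ℕ.* Q ℕ.* (Q ℕ.* Q) ℕ.+ 15 ℕ.* T ℕ.* (Q ℕ.* Q)) ∎)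
    ; large = fromNat-cancel-≤ (begin
        fromNat (Q ℕ.* Q ℕ.* (Q ℕ.* Q))      ≡⟨ fromNat-quartic Q ⟩
        X ⁴                                  ≤⟨ ⁴-mono 0≤X (≤-trans Q≤r+t (+-monoʳ-≤ r t≤1)) ⟩
        (r + 1ℚ) ⁴                           ≤⟨ [r+1]⁴≤8[r⁴+1] 0≤r ⟩
        fromNat 8 * (r ⁴ + 1ℚ)               ≤⟨ *-monoˡ (fromNat-nonNeg 8) (+-monoˡ-≤ 1ℚ r⁴≤N) ⟩
        fromNat 8 * (fromNat N + 1ℚ)         ≡⟨ trans (fromNat-* 8 (N ℕ.+ 1)) (cong (fromNat 8 *_) (fromNat-+ N 1)) ⟨
        fromNat (8 ℕ.* (N ℕ.+ 1))            ∎)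
    ; small = fromNat-cancel-≤ (begin
        fromNat N                            ≤⟨ N≤[X+t]⁴ ⟩
        (X + t) ⁴                            ≤⟨ [X+t]⁴≤16X⁴ 0≤t t≤1 1≤X Qt≤T ⟩
        fromNat 16 * (X * X * (X * X))
          ≡⟨ trans (fromNat-* 16 (Q ℕ.* Q ℕ.* (Q ℕ.* Q))) (cong (fromNat 16 *_) (fromNat-quartic Q)) ⟨
        fromNat (16 ℕ.* (Q ℕ.* Q ℕ.* (Q ℕ.* Q))) ∎)
    }
    where
    X = fromNat Q
    1≤X = 1≤fromNat Q
    0≤X = fromNat-nonNeg Q
    N≤[X+t]⁴ : fromNat N ≤ (X + t) ⁴
    N≤[X+t]⁴ = ≤-trans N≤s⁴ (⁴-mono 0≤s s≤Q+t)

  ∃-ceiling : ∀ {p} → 0ℚ ≤ p → ∃[ n ] NonZero n × p ≤ fromNat n × fromNat n ≤ p + 1ℚ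
  ∃-ceiling {p} 0≤p = go (limit 0 p) (<⇒≤ (q<grid 0 p))
    where
    go : ∀ n → p ≤ fromNat n → ∃[ n ] NonZero n × p ≤ fromNat n × fromNat n ≤ p + 1ℚ
    -- A ceiling of 0 is replaced by 1: `shell-count` absorbs `19 T + 1` into `20 T`.
    go zero p≤0 = 1 , _ , ≤-trans p≤0 (fromNat-nonNeg 1) , +-monoˡ-≤ 1ℚ 0≤p
    go (suc n) h with ≤-total p (fromNat n)
    ... | inj₁ p≤n = go n p≤n
    ... | inj₂ n≤p = suc n , _ , h , subst (_≤ p + 1ℚ)
      (trans (sym (fromNat-+ n 1)) (cong fromNat (ℕ.+-comm n 1))) (+-monoˡ-≤ 1ℚ n≤p)

open import Data.Nat.Base as ℕ using (ℕ; NonZero)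
open import Data.Product.Base using (∃-syntax; _×_)
open import Defs

import Algebra.Definitions.RawMonoid as RawMonoidDefinitions
open import Data.Bool.Base using (true; false; if_then_else_)
open import Data.Empty using (⊥)
open import Data.Fin.Base using (Fin; zero; suc; splitAt)
open import Data.Fin.Properties using () renaming (_≟_ to _≟ᶠ_)
open import Data.Integer.Base as ℤ using (ℤ; +_; -[1+_])
import Data.Integer.Properties as ℤ
open import Data.List.Base using (length)
import Data.Nat.Properties as ℕ
open import Data.Product.Base using (_,_; proj₁; proj₂)
open import Data.Rational.Base as ℚ using (ℚ; 0ℚ; 1ℚ; ½)
import Data.Rational.Properties as ℚ
open import Data.Rational.Solver using (module +-*-Solver)
open import Data.Sum.Base using (inj₁; inj₂)
open import Data.Vec.Base using (Vec; []; _∷_; lookup; zipWith)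
import Data.Vec.Properties as Vec
open import Data.Vec.Functional using (Vector)
open import Relation.Binary.PropositionalEquality
  using (_≡_; refl; sym; trans; cong; cong₂; subst; module ≡-Reasoning)
open import Relation.Nullary using (does)

open RawMonoidDefinitions ℤ.+-0-rawMonoid using () renaming (sum to sumℤ)
open RationalLemmas hiding (_²)
open CauchyLemmas
open Counting using (AtMost; atMost-⊆)
open LatticeCount
open RationalShell
open +-*-Solver using (solve; _:=_; _:+_; _:*_; :-_; _:-_; con)

-- Integral reals, and closeness of `φ₄` to `Q` read off at one index.

infix 4 _≗_

-- Finer than `_≈_`: every approximation equals the integer, so at each index `⁴√` approximates the
-- root of this very integer.
record _≗_ (x : ℝ) (z : ℤ) : Set where
  constructor constantly
  field at : ∀ k → approx x k ≡ fromInt z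

open _≗_

Integral : ℝ → Set
Integral x = ∃[ z ] x ≗ z

≗-* : ∀ x y {a b} → x ≗ a → y ≗ b → x * y ≗ a ℤ.* b
≗-* x y {a} {b} p q = constantly λ k → trans (cong₂ ℚ._*_ (at p k) (at q k)) (sym (fromInt-* a b))

≗-neg : ∀ x {a} → x ≗ a → - x ≗ ℤ.- a
≗-neg x {a} p = constantly λ k → trans (cong ℚ.-_ (at p k)) (sym (fromInt-neg a))

fromℤ-≗ : ∀ z → fromℤ z ≗ z
fromℤ-≗ z = constantly λ _ → refl

Integral-neg : ∀ x → Integral x → Integral (- x)
Integral-neg x (a , p) = ℤ.- a , ≗-neg x p

Integral-kronecker : ∀ {n} (i j : Fin n) → Integral (kronecker i j)
Integral-kronecker i j = indicator (does (i ≟ᶠ j))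
  where
  indicator : ∀ b → Integral (if b then 1ℝ else 0ℝ)
  indicator true  = + 1 , fromℤ-≗ (+ 1)
  indicator false = + 0 , fromℤ-≗ (+ 0)

Integral-J : ∀ n i j → Integral (J n i j)
Integral-J n i j with splitAt n i | splitAt n j
... | inj₁ _ | inj₁ _ = + 0 , fromℤ-≗ (+ 0)
... | inj₁ a | inj₂ b = Integral-kronecker a b
... | inj₂ a | inj₁ b = Integral-neg (kronecker a b) (Integral-kronecker a b)
... | inj₂ _ | inj₂ _ = + 0 , fromℤ-≗ (+ 0)

≗-sum : ∀ {m} (f : Vector ℝ m) (g : Vector ℤ m) → (∀ i → f i ≗ g i) → sum f ≗ sumℤ g
≗-sum {ℕ.zero}  f g h = constantly λ _ → refl
≗-sum {ℕ.suc m} f g h = constantly λ k →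
  trans (cong₂ ℚ._+_ (at (h zero) k) (at (≗-sum (λ i → f (suc i)) (λ i → g (suc i)) (λ i → h (suc i))) k))
    (sym (fromInt-+ (g zero) (sumℤ λ i → g (suc i))))

symplecticℤ : ∀ n → Vector ℤ (n ℕ.+ n) → Vector ℤ (n ℕ.+ n) → ℤ
symplecticℤ n a b = sumℤ λ i → sumℤ λ j → a i ℤ.* proj₁ (Integral-J n i j) ℤ.* b j

≗-symplectic : ∀ n x y a b → (∀ i → x i ≗ a i) → (∀ i → y i ≗ b i) → symplectic n x y ≗ symplecticℤ n a b
≗-symplectic n x y a b x≗a y≗b =
  ≗-sum (λ i → sum λ j → x i * J n i j * y j) _ λ i → ≗-sum (λ j → x i * J n i j * y j) _ λ j →
    ≗-* (x i * J n i j) (y j) (≗-* (x i) (J n i j) (x≗a i) (proj₂ (Integral-J n i j))) (y≗b j)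

∣i∣*∣i∣≡i*i : ∀ i → + (ℤ.∣ i ∣ ℕ.* ℤ.∣ i ∣) ≡ i ℤ.* i
∣i∣*∣i∣≡i*i (+ m)    = ℤ.pos-* m m
∣i∣*∣i∣≡i*i -[1+ m ] = refl

∣∣²-≗ : ∀ {m} (f : Vector ℝ m) (a : Vec ℤ m) → (∀ i → f i ≗ lookup a i) → ∣ f ∣² ≗ + normSq a
∣∣²-≗ f []      h = constantly λ _ → refl
∣∣²-≗ f (x ∷ a) h = constantly λ k →
  trans (cong₂ ℚ._+_ (trans (cong₂ ℚ._*_ (at (h zero) k) (at (h zero) k)) square)
      (at (∣∣²-≗ (λ i → f (suc i)) a (λ i → h (suc i))) k))
    (sym (fromNat-+ (ℤ.∣ x ∣ ℕ.* ℤ.∣ x ∣) (normSq a)))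
  where
  square : fromInt x ℚ.* fromInt x ≡ fromNat (ℤ.∣ x ∣ ℕ.* ℤ.∣ x ∣)
  square = sym (trans (cong fromInt (∣i∣*∣i∣≡i*i x)) (fromInt-* x x))

-- The radicand of `‖_‖₄`: by definition `φ₄ u v` is `⁴√` of its value at `u ∗ v ⁻¹`.
norm⁴ : ∀ {n} → Point n → ℝ
norm⁴ ⟨ x , s ⟩ = ∣ x ∣² ² + fromℕ 16 * s ²

-- `16 (z / 2)² = 4 z²`, so the half-integral vertical part contributes an integer.
norm⁴-≗ : ∀ {n} (p : Point n) (a : Vec ℤ (n ℕ.+ n)) z → (∀ i → Point.horizontal p i ≗ lookup a i) →
  (∀ k → approx (Point.vertical p) k ≡ ½ ℚ.* fromInt z) → norm⁴ p ≗ + korányi⁴ (a , z)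
norm⁴-≗ ⟨ x , s ⟩ a z x≗a s≡z/2 = constantly λ k → begin
  approx ∣ x ∣² k ℚ.* approx ∣ x ∣² k ℚ.+ fromNat 16 ℚ.* (approx s k ℚ.* approx s k)
    ≡⟨ cong₂ ℚ._+_ (cong₂ ℚ._*_ (at (∣∣²-≗ x a x≗a) k) (at (∣∣²-≗ x a x≗a) k))
         (cong (fromNat 16 ℚ.*_) (cong₂ ℚ._*_ (s≡z/2 k) (s≡z/2 k))) ⟩
  fromNat S ℚ.* fromNat S ℚ.+ fromNat 16 ℚ.* ((½ ℚ.* fromInt z) ℚ.* (½ ℚ.* fromInt z))
    ≡⟨ solve 2 (λ S z → S :* S :+ con (fromNat 16) :* ((con ½ :* z) :* (con ½ :* z)) :=
         S :* S :+ con (fromNat 4) :* (z :* z)) refl (fromNat S) (fromInt z) ⟩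
  fromNat S ℚ.* fromNat S ℚ.+ fromNat 4 ℚ.* (fromInt z ℚ.* fromInt z)
    ≡⟨ cong₂ ℚ._+_ (fromNat-* S S) (trans (fromNat-* 4 (ℤ.∣ z ∣ ℕ.* ℤ.∣ z ∣))
         (cong (fromNat 4 ℚ.*_) (trans (cong fromInt (∣i∣*∣i∣≡i*i z)) (fromInt-* z z)))) ⟨
  fromNat (S ℕ.* S) ℚ.+ fromNat (4 ℕ.* (ℤ.∣ z ∣ ℕ.* ℤ.∣ z ∣))
    ≡⟨ fromNat-+ (S ℕ.* S) (4 ℕ.* (ℤ.∣ z ∣ ℕ.* ℤ.∣ z ∣)) ⟨
  fromNat (korányi⁴ (a , z)) ∎
  where
  open ≡-Reasoning
  S = normSq a

-- the symplectic form of b and - c, the horizontal parts of u and v ⁻¹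
form : ∀ n → Vec ℤ (n ℕ.+ n) → Vec ℤ (n ℕ.+ n) → ℤ
form n b c = symplecticℤ n (lookup b) (λ i → ℤ.- lookup c i)

∗-vertical : ∀ {n} (p q : Point n) {s t σ} → Point.vertical p ≗ s → Point.vertical q ≗ t →
  symplectic n (Point.horizontal p) (Point.horizontal q) ≗ σ →
  ∀ k → approx (Point.vertical (p ∗ q)) k ≡ ½ ℚ.* fromInt (+ 2 ℤ.* (s ℤ.+ t) ℤ.+ σ)
∗-vertical p q {s} {t} {σ} ps qt pq k = begin
  approx (Point.vertical (p ∗ q)) k
    ≡⟨ cong₂ ℚ._+_ (cong₂ ℚ._+_ (at ps k) (at qt k)) (cong (½ ℚ.*_) (at pq k)) ⟩
  fromInt s ℚ.+ fromInt t ℚ.+ ½ ℚ.* fromInt σ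
    ≡⟨ solve 3 (λ s t σ → s :+ t :+ con ½ :* σ := con ½ :* (con (fromNat 2) :* (s :+ t) :+ σ)) refl
         (fromInt s) (fromInt t) (fromInt σ) ⟩
  ½ ℚ.* (fromNat 2 ℚ.* (fromInt s ℚ.+ fromInt t) ℚ.+ fromInt σ)
    ≡⟨ cong (½ ℚ.*_) (trans (fromInt-+ (+ 2 ℤ.* (s ℤ.+ t)) σ) (cong (ℚ._+ fromInt σ)
         (trans (fromInt-* (+ 2) (s ℤ.+ t)) (cong (fromNat 2 ℚ.*_) (fromInt-+ s t))))) ⟨
  ½ ℚ.* fromInt (+ 2 ℤ.* (s ℤ.+ t) ℤ.+ σ) ∎
  where open ≡-Reasoning

difference-≗ : ∀ n (u v : LatticePoint n) →
  norm⁴ (⟦ u ⟧ ∗ ⟦ v ⟧ ⁻¹) ≗ + korányi⁴ (difference (form n) u v)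
difference-≗ n u@(⟨ b , y ⟩) v@(⟨ c , z ⟩) =
  norm⁴-≗ (⟦ u ⟧ ∗ ⟦ v ⟧ ⁻¹) (zipWith ℤ._-_ b c) (+ 2 ℤ.* (y ℤ.- z) ℤ.+ form n b c)
    (λ i → constantly λ k → trans (cong (fromInt (lookup b i) ℚ.+_) (at (-c i) k))
      (trans (sym (fromInt-+ (lookup b i) (ℤ.- lookup c i)))
        (cong fromInt (sym (Vec.lookup-zipWith ℤ._-_ i b c)))))
    (∗-vertical ⟦ u ⟧ (⟦ v ⟧ ⁻¹) {y} {ℤ.- z} (constantly λ _ → refl) (constantly λ _ → sym (fromInt-neg z))
      (≗-symplectic n (Point.horizontal ⟦ u ⟧) (Point.horizontal (⟦ v ⟧ ⁻¹))
        (lookup b) (λ i → ℤ.- lookup c i) (λ i → constantly λ _ → refl) -c))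
  where
  -c : ∀ i → Point.horizontal (⟦ v ⟧ ⁻¹) i ≗ ℤ.- lookup c i
  -c i = constantly λ _ → sym (fromInt-neg (lookup c i))

-- From index `k₀` on, `t = δₖ + 2 ε` meets the upper bounds that `thinShell` asks for. One `ε` is
-- the slack in the real inequality for `φ₄`, the other the rounding error of the root.
record Tube (δ : ℝ) (Q T : ℕ) : Set where
  field
    ε     : ℚ
    0<ε   : 0ℚ ℚ.< ε
    k₀    : ℕ
    ≤1    : ∀ k → k₀ ℕ.≤ k → approx δ k ℚ.+ ε ℚ.+ ε ℚ.≤ 1ℚ
    ≤T    : ∀ k → k₀ ℕ.≤ k → fromNat Q ℚ.* (approx δ k ℚ.+ ε ℚ.+ ε) ℚ.≤ fromNat T

-- A single index `k` suffices, since `x` is constantly `N`: there `root x k` and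
-- `root x k + grid k 1` enclose the fourth root of `N` and serve as `r` and `s` in `thinShell`.
∣⁴√-Q∣≤δ⇒ThinShell : ∀ {x δ N Q T} .{{_ : NonZero Q}} → Tube δ Q T → x ≗ + N →
  ∣ ⁴√ x - fromℕ Q ∣ ≤ δ → ThinShell Q T N
∣⁴√-Q∣≤δ⇒ThinShell {x} {δ} {N} {Q} {T} tube x≗N close =
  let k₁ , near = close ε 0<ε
      k₂ , fine = archimedean 0<ε
      k = k₀ ℕ.⊔ (k₁ ℕ.⊔ k₂)
  in shell k (ℕ.m≤m⊔n k₀ _) (near k (⊔ˡ {k₁} (⊔ʳ {k₀} ℕ.≤-refl)))
       (ℚ.≤-trans (grid-anti {k₂} {k} (⊔ʳ {k₁} (⊔ʳ {k₀} ℕ.≤-refl))) fine)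
  where
  open Tube tube
  open ℚ.≤-Reasoning
  shell : ∀ k → k₀ ℕ.≤ k → approx (∣ ⁴√ x - fromℕ Q ∣) k ℚ.≤ approx δ k ℚ.+ ε → grid k 1 ℚ.≤ ε → ThinShell Q T N
  shell k k₀≤k near h≤ε = thinShell 0≤t (≤1 k k₀≤k) (≤T k k₀≤k) 0≤r (+-nonNeg 0≤r (grid-nonNeg k 1))
    (subst (r ⁴ ℚ.≤_) clip≡N (root⁴-lower k clip (0≤clip x k)))
    (subst (ℚ._≤ (r ℚ.+ h) ⁴) clip≡N (ℚ.<⇒≤ (root⁴-upper k clip)))
    (begin
      r ℚ.+ h                        ≤⟨ ℚ.+-mono-≤ r≤X+a h≤ε ⟩
      X ℚ.+ a ℚ.+ ε                  ≡⟨ ℚ.+-assoc X a ε ⟩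
      X ℚ.+ (a ℚ.+ ε)                ∎)
    (begin
      X                              ≤⟨ X≤r+a ⟩
      r ℚ.+ a                        ≤⟨ ℚ.+-monoʳ-≤ r (p≤p+q (ℚ.<⇒≤ 0<ε)) ⟩
      r ℚ.+ (a ℚ.+ ε)                ∎)
    where
    X = fromNat Q
    clip = 0ℚ ℚ.⊔ approx x k
    r = root x k
    h = grid k 1
    a = approx δ k ℚ.+ ε
    0≤r = root⁴-nonNeg k clip
    clip≡N : clip ≡ fromNat N
    clip≡N = trans (cong (0ℚ ℚ.⊔_) (at x≗N k)) (ℚ.p≤q⇒p⊔q≡q (fromNat-nonNeg N))
    d = r ℚ.+ ℚ.- X
    d≤a : d ℚ.≤ a
    d≤a = ℚ.≤-trans (ℚ.p≤p⊔q d (ℚ.- d)) near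
    -d≤a : ℚ.- d ℚ.≤ a
    -d≤a = ℚ.≤-trans (ℚ.p≤q⊔p d (ℚ.- d)) near
    r≤X+a : r ℚ.≤ X ℚ.+ a
    r≤X+a = subst (ℚ._≤ X ℚ.+ a) (solve 2 (λ r X → X :+ (r :+ :- X) := r) refl r X) (ℚ.+-monoʳ-≤ X d≤a)
    X≤r+a : X ℚ.≤ r ℚ.+ a
    X≤r+a = subst (ℚ._≤ r ℚ.+ a) (solve 2 (λ r X → r :+ :- (r :+ :- X) := X) refl r X) (ℚ.+-monoʳ-≤ r -d≤a)
    0≤a : 0ℚ ℚ.≤ a
    0≤a with ℚ.≤-total 0ℚ d
    ... | inj₁ 0≤d = ℚ.≤-trans 0≤d d≤a
    ... | inj₂ d≤0 = ℚ.≤-trans (ℚ.neg-antimono-≤ d≤0) -d≤a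
    0≤t : 0ℚ ℚ.≤ a ℚ.+ ε
    0≤t = +-nonNeg 0≤a (ℚ.<⇒≤ 0<ε)

∃-Tube : ∀ δ → 0ℝ < δ → δ < 1ℝ → ∀ Q .{{_ : NonZero Q}} → ∃[ T ] NonZero T ×
  (∃[ tube ] (∀ k → Tube.k₀ {δ} {Q} {T} tube ℕ.≤ k →
    fromNat T ℚ.≤ fromNat Q ℚ.* approx δ k ℚ.+ fromNat 5))
∃-Tube δ (ε₁ , 0<ε₁ , k₁ , pos) (ε₂ , 0<ε₂ , k₂ , lt) Q =
  let η , 0<η , Xη≡1 = scale {1ℚ} {X} (ℚ.positive⁻¹ 1ℚ) 0<X
      -- `half ε₂` keeps `δₖ + 2 ε` at most 1, and `η = 1 / Q` makes `Q ε ≤ 1`.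
      ε = half ε₂ ℚ.⊓ η
      0<ε = ⊓-pos (half-pos 0<ε₂) 0<η
      Xε≤1 = ℚ.≤-trans (*-monoˡ 0≤X (ℚ.p⊓q≤q (half ε₂) η)) (ℚ.≤-reflexive Xη≡1)
      k₃ , slow = oneSided δ ε 0<ε
      k₀ = k₁ ℕ.⊔ (k₂ ℕ.⊔ k₃)
      δ₀ = approx δ k₀
      0≤δ₀ : 0ℚ ℚ.≤ δ₀
      0≤δ₀ = ℚ.≤-trans (ℚ.<⇒≤ 0<ε₁) (subst (ℚ._≤ δ₀) (ℚ.+-identityˡ ε₁) (pos k₀ (ℕ.m≤m⊔n k₁ _)))
      -- The 3 pays for three errors `Q ε`: the two in `Tube` and the variation of `δ` after `k₀`.
      -- In the upper bound, 5 is this 3, 1 for the ceiling and 1 for the variation of `δ`.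
      T , T≢0 , lower , upper = ∃-ceiling (+-nonNeg (*-nonNeg 0≤X 0≤δ₀) (fromNat-nonNeg 3))
      k₂≤ : ∀ {k} → k₀ ℕ.≤ k → k₂ ℕ.≤ k
      k₂≤ = λ p → ⊔ˡ {k₂} (⊔ʳ {k₁} p)
      k₃≤ : ∀ {k} → k₀ ℕ.≤ k → k₃ ℕ.≤ k
      k₃≤ = λ p → ⊔ʳ {k₂} (⊔ʳ {k₁} p)
  in T , T≢0 , record
    { ε = ε ; 0<ε = 0<ε ; k₀ = k₀
    ; ≤1 = λ k p → ≤1 ε k (ℚ.p⊓q≤p (half ε₂) η) (lt k (k₂≤ p))
    ; ≤T = λ k p → ≤T ε δ₀ (approx δ k) Xε≤1 (slow k k₀ (k₃≤ p) (k₃≤ {k₀} ℕ.≤-refl)) lower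
    } , λ k p → T≤ ε δ₀ (approx δ k) Xε≤1 (slow k₀ k (k₃≤ {k₀} ℕ.≤-refl) (k₃≤ p)) upper
  where
  open ℚ.≤-Reasoning
  X = fromNat Q
  0≤X = fromNat-nonNeg Q
  0<X : 0ℚ ℚ.< X
  0<X = ℚ.<-≤-trans (ℚ.positive⁻¹ 1ℚ) (1≤fromNat Q)
  ⊓-pos : ∀ {p q} → 0ℚ ℚ.< p → 0ℚ ℚ.< q → 0ℚ ℚ.< p ℚ.⊓ q
  ⊓-pos {p} {q} 0<p 0<q with ℚ.⊓-sel p q
  ... | inj₁ eq = subst (0ℚ ℚ.<_) (sym eq) 0<p
  ... | inj₂ eq = subst (0ℚ ℚ.<_) (sym eq) 0<q
  ≤1 : ∀ ε k → ε ℚ.≤ half ε₂ → approx δ k ℚ.+ ε₂ ℚ.≤ 1ℚ → approx δ k ℚ.+ ε ℚ.+ ε ℚ.≤ 1ℚ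
  ≤1 ε k ε≤ δ≤ = begin
    approx δ k ℚ.+ ε ℚ.+ ε                     ≡⟨ ℚ.+-assoc (approx δ k) ε ε ⟩
    approx δ k ℚ.+ (ε ℚ.+ ε)                   ≤⟨ ℚ.+-monoʳ-≤ (approx δ k) (ℚ.+-mono-≤ ε≤ ε≤) ⟩
    approx δ k ℚ.+ (half ε₂ ℚ.+ half ε₂)       ≡⟨ cong (approx δ k ℚ.+_) (half+half ε₂) ⟩
    approx δ k ℚ.+ ε₂                          ≤⟨ δ≤ ⟩
    1ℚ                                         ∎
  ≤T : ∀ ε d₀ d {T} → X ℚ.* ε ℚ.≤ 1ℚ → d ℚ.≤ d₀ ℚ.+ ε → X ℚ.* d₀ ℚ.+ fromNat 3 ℚ.≤ T →
    X ℚ.* (d ℚ.+ ε ℚ.+ ε) ℚ.≤ T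
  ≤T ε d₀ d {T} Xε≤1 d≤ lower = begin
    X ℚ.* (d ℚ.+ ε ℚ.+ ε)                      ≤⟨ *-monoˡ 0≤X (ℚ.+-monoˡ-≤ ε (ℚ.+-monoˡ-≤ ε d≤)) ⟩
    X ℚ.* (d₀ ℚ.+ ε ℚ.+ ε ℚ.+ ε)
      ≡⟨ solve 3 (λ X d e → X :* (d :+ e :+ e :+ e) := X :* d :+ con (fromNat 3) :* (X :* e)) refl X d₀ ε ⟩
    X ℚ.* d₀ ℚ.+ fromNat 3 ℚ.* (X ℚ.* ε)       ≤⟨ ℚ.+-monoʳ-≤ (X ℚ.* d₀) (*-monoˡ (fromNat-nonNeg 3) Xε≤1) ⟩
    X ℚ.* d₀ ℚ.+ fromNat 3                     ≤⟨ lower ⟩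
    T                                          ∎
  T≤ : ∀ ε d₀ d {T} → X ℚ.* ε ℚ.≤ 1ℚ → d₀ ℚ.≤ d ℚ.+ ε → T ℚ.≤ X ℚ.* d₀ ℚ.+ fromNat 3 ℚ.+ 1ℚ →
    T ℚ.≤ X ℚ.* d ℚ.+ fromNat 5
  T≤ ε d₀ d {T} Xε≤1 d₀≤ upper = begin
    T                                          ≤⟨ upper ⟩
    X ℚ.* d₀ ℚ.+ fromNat 3 ℚ.+ 1ℚ              ≤⟨ ℚ.+-monoˡ-≤ 1ℚ (ℚ.+-monoˡ-≤ (fromNat 3) (*-monoˡ 0≤X d₀≤)) ⟩
    X ℚ.* (d ℚ.+ ε) ℚ.+ fromNat 3 ℚ.+ 1ℚ
      ≡⟨ solve 3 (λ X d e → X :* (d :+ e) :+ con (fromNat 3) :+ con 1ℚ := X :* d :+ con (fromNat 4) :+ X :* e) refl X d ε ⟩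
    X ℚ.* d ℚ.+ fromNat 4 ℚ.+ X ℚ.* ε          ≤⟨ ℚ.+-monoʳ-≤ (X ℚ.* d ℚ.+ fromNat 4) Xε≤1 ⟩
    X ℚ.* d ℚ.+ fromNat 4 ℚ.+ 1ℚ               ≡⟨ ℚ.+-assoc (X ℚ.* d) (fromNat 4) 1ℚ ⟩
    X ℚ.* d ℚ.+ fromNat 5                      ∎

-- An integral box in place of the real one, and the final constant.

fromNat-∣∣≤ : ∀ z → fromNat ℤ.∣ z ∣ ℚ.≤ fromInt z ℚ.⊔ ℚ.- fromInt z
fromNat-∣∣≤ (+ m)      = ℚ.p≤p⊔q (fromNat m) _
fromNat-∣∣≤ z@(-[1+ m ]) = subst (ℚ._≤ fromInt z ℚ.⊔ ℚ.- fromInt z) (sym (fromInt-neg z)) (ℚ.p≤q⊔p (fromInt z) _)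

1+n≰n+½ : ∀ n → fromNat (ℕ.suc n) ℚ.≤ fromNat n ℚ.+ ½ → ⊥
1+n≰n+½ n le = ℚ.<-irrefl refl (begin-strict
  fromNat n ℚ.+ ½       <⟨ ℚ.+-monoʳ-< (fromNat n) (ℚ.*<* (ℤ.+<+ (ℕ.s≤s (ℕ.s≤s ℕ.z≤n)))) ⟩
  fromNat n ℚ.+ 1ℚ      ≡⟨ trans (cong fromNat (ℕ.+-comm 1 n)) (fromNat-+ n 1) ⟨
  fromNat (ℕ.suc n)     ≤⟨ le ⟩
  fromNat n ℚ.+ ½       ∎)
  where open ℚ.≤-Reasoning

-- `C` exceeds the approximations of `c` from some index on. The real inequality is tested with
-- slack `½`: an integer above `C m` exceeds it by at least 1.
∃-upper-bound : ∀ c → ∃[ C ] (∀ z m → ∣ fromℤ z ∣ ≤ c * fromℕ m → ℤ.∣ z ∣ ℕ.≤ C ℕ.* m)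
∃-upper-bound c =
  let B , _ , N , c≤B = bounded c
      C = limit 0 B
  in C , λ z m le → ℕ.≮⇒≥ λ Cm<z →
    let M , le′ = le ½ (ℚ.positive⁻¹ ½)
        k = N ℕ.⊔ M
    in 1+n≰n+½ (C ℕ.* m) (estimate C z m k Cm<z (le′ k (⊔ʳ {N} ℕ.≤-refl))
         (ℚ.≤-trans (p≤∣p∣ (approx c k)) (ℚ.≤-trans (c≤B k (⊔ˡ {N} ℕ.≤-refl)) (ℚ.<⇒≤ (q<grid 0 B)))))
  where
  open ℚ.≤-Reasoning
  estimate : ∀ C z m k → C ℕ.* m ℕ.< ℤ.∣ z ∣ →
    fromInt z ℚ.⊔ ℚ.- fromInt z ℚ.≤ approx c k ℚ.* fromNat m ℚ.+ ½ → approx c k ℚ.≤ fromNat C →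
    fromNat (ℕ.suc (C ℕ.* m)) ℚ.≤ fromNat (C ℕ.* m) ℚ.+ ½
  estimate C z m k Cm<z le c≤C = begin
    fromNat (ℕ.suc (C ℕ.* m))       ≤⟨ fromNat-mono {ℕ.suc (C ℕ.* m)} {ℤ.∣ z ∣} Cm<z ⟩
    fromNat ℤ.∣ z ∣                 ≤⟨ fromNat-∣∣≤ z ⟩
    fromInt z ℚ.⊔ ℚ.- fromInt z     ≤⟨ le ⟩
    approx c k ℚ.* fromNat m ℚ.+ ½
      ≤⟨ ℚ.+-monoˡ-≤ ½ (ℚ.*-monoʳ-≤-nonNeg (fromNat m) {{ℚ.nonNegative (fromNat-nonNeg m)}} c≤C) ⟩
    fromNat C ℚ.* fromNat m ℚ.+ ½   ≡⟨ cong (ℚ._+ ½) (fromNat-* C m) ⟨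
    fromNat (C ℕ.* m) ℚ.+ ½         ∎

-- The factor 6 comes from Q ^ d * (Q * δ + 5) ≤ 6 * max (Q ^ d) (Q ^ (d + 1) * δ).
normalise : ∀ {d e E Q T l : ℕ} {δ : ℚ} .{{_ : NonZero Q}} → l ℕ.≤ E ℕ.* (Q ℕ.^ e ℕ.* (Q ℕ.^ d ℕ.* T)) →
  fromNat T ℚ.≤ fromNat Q ℚ.* δ ℚ.+ fromNat 5 →
  ((+ 1 ℚ./ (Q ℕ.^ e)) {{ℕ.m^n≢0 Q e}}) ℚ.* fromNat l ℚ.≤
    fromNat (ℕ.suc (6 ℕ.* E)) ℚ.* (fromNat (Q ℕ.^ d) ℚ.⊔ fromNat (Q ℕ.^ (d ℕ.+ 1)) ℚ.* δ)
normalise {d} {e} {E} {Q} {T} {l} {δ} l≤ T≤ = begin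
  w ℚ.* fromNat l
    ≤⟨ *-monoˡ 0≤w (fromNat-mono {l} l≤) ⟩
  w ℚ.* fromNat (E ℕ.* (Q ℕ.^ e ℕ.* (Q ℕ.^ d ℕ.* T)))
    ≡⟨ cong (w ℚ.*_) (trans (fromNat-* E (Q ℕ.^ e ℕ.* (Q ℕ.^ d ℕ.* T))) (cong (fromNat E ℚ.*_)
         (trans (fromNat-* (Q ℕ.^ e) (Q ℕ.^ d ℕ.* T)) (cong (fromNat (Q ℕ.^ e) ℚ.*_) (fromNat-* (Q ℕ.^ d) T))))) ⟩
  w ℚ.* (fromNat E ℚ.* (fromNat (Q ℕ.^ e) ℚ.* (Y ℚ.* fromNat T)))
    ≡⟨ solve 5 (λ w E R Y T → w :* (E :* (R :* (Y :* T))) := w :* R :* (E :* (Y :* T))) refl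
         w (fromNat E) (fromNat (Q ℕ.^ e)) Y (fromNat T) ⟩
  w ℚ.* fromNat (Q ℕ.^ e) ℚ.* (fromNat E ℚ.* (Y ℚ.* fromNat T))
    ≡⟨ trans (cong (ℚ._* (fromNat E ℚ.* (Y ℚ.* fromNat T))) (1/n*n≡1 (Q ℕ.^ e) {{ℕ.m^n≢0 Q e}})) (ℚ.*-identityˡ _) ⟩
  fromNat E ℚ.* (Y ℚ.* fromNat T)
    ≤⟨ *-monoˡ (fromNat-nonNeg E) (*-monoˡ (fromNat-nonNeg (Q ℕ.^ d)) T≤) ⟩
  fromNat E ℚ.* (Y ℚ.* (fromNat Q ℚ.* δ ℚ.+ fromNat 5))
    ≡⟨ cong (fromNat E ℚ.*_) (trans
         (solve 3 (λ Y Q δ → Y :* (Q :* δ :+ con (fromNat 5)) := Y :* Q :* δ :+ con (fromNat 5) :* Y) refl Y (fromNat Q) δ)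
         (cong (λ p → p ℚ.* δ ℚ.+ fromNat 5 ℚ.* Y) (sym Q^[d+1]))) ⟩
  fromNat E ℚ.* (Z ℚ.* δ ℚ.+ fromNat 5 ℚ.* Y)
    ≤⟨ *-monoˡ (fromNat-nonNeg E) (ℚ.+-mono-≤ (ℚ.p≤q⊔p Y (Z ℚ.* δ)) (*-monoˡ (fromNat-nonNeg 5) (ℚ.p≤p⊔q Y (Z ℚ.* δ)))) ⟩
  fromNat E ℚ.* (m ℚ.+ fromNat 5 ℚ.* m)
    ≡⟨ trans (solve 2 (λ E m → E :* (m :+ con (fromNat 5) :* m) := con (fromNat 6) :* E :* m) refl (fromNat E) m)
         (cong (ℚ._* m) (sym (fromNat-* 6 E))) ⟩
  fromNat (6 ℕ.* E) ℚ.* m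
    -- The successor makes the constant visibly positive, as `0ℝ < K` demands.
    ≤⟨ ℚ.*-monoʳ-≤-nonNeg m {{ℚ.nonNegative 0≤m}} (fromNat-mono {6 ℕ.* E} (ℕ.n≤1+n _)) ⟩
  fromNat (ℕ.suc (6 ℕ.* E)) ℚ.* m ∎
  where
  open ℚ.≤-Reasoning
  w = (+ 1 ℚ./ (Q ℕ.^ e)) {{ℕ.m^n≢0 Q e}}
  Y = fromNat (Q ℕ.^ d)
  Z = fromNat (Q ℕ.^ (d ℕ.+ 1))
  m = Y ℚ.⊔ Z ℚ.* δ
  0≤w : 0ℚ ℚ.≤ w
  0≤w = ℚ.nonNegative⁻¹ w {{ℚ.normalize-nonNeg 1 (Q ℕ.^ e) {{ℕ.m^n≢0 Q e}}}}
  0≤m : 0ℚ ℚ.≤ m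
  0≤m = ℚ.≤-trans (fromNat-nonNeg (Q ℕ.^ d)) (ℚ.p≤p⊔q Y (Z ℚ.* δ))
  Q^[d+1] : Z ≡ Y ℚ.* fromNat Q
  Q^[d+1] = trans (cong fromNat (trans (ℕ.^-distribˡ-+-* Q d 1) (cong (Q ℕ.^ d ℕ.*_) (ℕ.*-identityʳ Q))))
    (fromNat-* (Q ℕ.^ d) Q)

ClosePair-count : ∀ n .{{_ : NonZero n}} {c δ C Q T} .{{_ : NonZero Q}} .{{T≢0 : NonZero T}} →
  (∀ z m → ∣ fromℤ z ∣ ≤ c * fromℕ m → ℤ.∣ z ∣ ℕ.≤ C ℕ.* m) → Tube δ Q T →
  AtMost (pair-constant C n ℕ.* (Q ℕ.^ (2 ℕ.* n ℕ.+ 2) ℕ.* (Q ℕ.^ (2 ℕ.* n) ℕ.* T))) (ClosePair n c δ Q)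
ClosePair-count n {c} {δ} {C} {Q} {T} c≤C tube =
  subst (λ d → AtMost (pair-constant C n ℕ.* (Q ℕ.^ (d ℕ.+ 2) ℕ.* (Q ℕ.^ d ℕ.* T))) (ClosePair n c δ Q))
    (cong (n ℕ.+_) (sym (ℕ.+-identityʳ n)))
    (atMost-⊆ (λ { {u , v} → close⇒ u v }) (pair-count n (form n) C Q T))
  where
  close⇒ : ∀ u v → ClosePair n c δ Q (u , v) →
    BoxPoint (form n) C Q v × ThinShell Q T (korányi⁴ (difference (form n) u v))
  close⇒ u v@(⟨ b , z ⟩) (_ , (b∈ , z∈) , close) =
    ((λ i → c≤C (lookup b i) Q (b∈ i)) , c≤C z (Q ℕ.^ 2) z∈) ,
    ∣⁴√-Q∣≤δ⇒ThinShell {x = norm⁴ (⟦ u ⟧ ∗ ⟦ v ⟧ ⁻¹)} tube (difference-≗ n u v) close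

theorem1p1 : (n : ℕ) .{{_ : NonZero n}} (c : ℝ) → 0ℝ < c →
    ∃[ K ] 0ℝ < K ×
    ((δ : ℝ) → 0ℝ < δ → δ < 1ℝ → (Q : ℕ) .{{_ : NonZero Q}} →
    (Q ^- (2 ℕ.* n ℕ.+ 2)) ·# ClosePair n c δ Q ≤
    K * (fromℕ (Q ℕ.^ (2 ℕ.* n)) ⊔ fromℕ (Q ℕ.^ (2 ℕ.* n ℕ.+ 1)) * δ))
theorem1p1 n c 0<c =
  fromℕ (ℕ.suc (6 ℕ.* E)) , (1ℚ , ℚ.positive⁻¹ 1ℚ , 0 , λ _ _ → 1≤fromNat (ℕ.suc (6 ℕ.* E))) , bound
  where
  C = proj₁ (∃-upper-bound c)
  E = pair-constant C n
  bound : (δ : ℝ) → 0ℝ < δ → δ < 1ℝ → (Q : ℕ) .{{_ : NonZero Q}} →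
    (Q ^- (2 ℕ.* n ℕ.+ 2)) ·# ClosePair n c δ Q ≤
    fromℕ (ℕ.suc (6 ℕ.* E)) * (fromℕ (Q ℕ.^ (2 ℕ.* n)) ⊔ fromℕ (Q ℕ.^ (2 ℕ.* n ℕ.+ 1)) * δ)
  bound δ 0<δ δ<1 Q xs u pxs ε 0<ε =
    let T , T≢0 , tube , T≤ = ∃-Tube δ 0<δ δ<1 Q
    -- From `k₀` on the inequality holds between the approximations themselves, so one index serves
    -- every `ε`.
    in Tube.k₀ tube , λ k k≥ → ℚ.≤-trans
         (normalise {2 ℕ.* n} {2 ℕ.* n ℕ.+ 2} {E} {Q} {T} {length xs} {approx δ k}
           (ClosePair-count n {c = c} {δ} {C} {Q} {T} {{T≢0 = T≢0}} (proj₂ (∃-upper-bound c)) tube xs u pxs) (T≤ k k≥))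
         (p≤p+q (ℚ.<⇒≤ 0<ε))
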